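{- Let $G_1=(V,E_1)$, $G_2=(V,E_2)$, $G_3=(V,E_3)$ be three simple graphs on the same finite vertex set $V$ with $|V|=m$. Let $\delta_1$ be the minimum degree of $G_1$ and let $\Delta_2$, $\Delta_3$ be the maximum degrees of $G_2$, $G_3$ respectively. Let $\ell\geq 2$ and $q\geq 1$ be integers, and assume \[ m\left(\frac{(2\ell-1)^2-1}{(2\ell-1)^2}\right)+\frac{4\ell-3+q}{(2\ell-1)^2}\leq \delta_1 \quad\text{and}\quad \Delta_2\Delta_3\leq \frac{q-1}{5\ell(2\ell-1)}. \] Then there exists a Hamiltonian cycle $H$ on $V$ such that $H^{\ell-1}$ is a subgraph of $G_1$ and $H^{\ell-1}$ does not form an alternating-$(\ell,2,\ell,2)$-bag with $G_2$ and $G_3$.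
   Context: A Hamiltonian cycle on $V$ is a cycle $v_0v_1\cdots v_{m-1}v_0$ passing through every vertex of $V$ exactly once. For a graph $J$ and integer $p\geq 0$, the $p$th power $J^p$ has vertex set $V(J)$ and an edge $uv$ whenever $u\neq v$ and the distance between $u$ and $v$ in $J$ is at most $p$. For a subgraph $J_1$ of $G_1$, we say $J_1$ forms an alternating-$(\ell,2,\ell,2)$-bag with $G_2$ and $G_3$ if there exist two vertex-disjoint copies $A_1,A_2$ of the complete graph $K_\ell$ in $J_1$ and two vertex-disjoint edges $e_2\in E_2$, $e_3\in E_3$ such that each of $e_2$ and $e_3$ joins a vertex of $A_1$ to a vertex of $A_2$. -}

module Defs where

open import Data.Nat using (ℕ; zero; suc; _+_; _*_; _∸_; _≤_; _⊓_; _⊔_)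
open import Data.Fin using (Fin; toℕ)
open import Data.Bool using (Bool; true; false; if_then_else_)
open import Data.List using (List; []; _∷_; map; foldr; allFin)
open import Data.Nat.ListAction using (sum)
open import Data.Product using (Σ; ∃; _×_; _,_)
open import Relation.Binary.PropositionalEquality using (_≡_; _≢_)
open import Function.Definitions using (Injective)

record Graph (m : ℕ) : Set where
  field
    adj    : Fin m → Fin m → Bool
    sym    : ∀ u v → adj u v ≡ adj v u
    irrefl : ∀ v → adj v v ≡ false
open Graph public

degree : ∀ {m} → Graph m → Fin m → ℕ
degree {m} G v = sum (map (λ w → if adj G v w then 1 else 0) (allFin m))

minList : List ℕ → ℕ
minList []           = 0
minList (x ∷ [])     = x
minList (x ∷ y ∷ xs) = x ⊓ minList (y ∷ xs)

-- minimum degree (convention: 0 for the empty vertex set)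
minDegree : ∀ {m} → Graph m → ℕ
minDegree {m} G = minList (map (degree G) (allFin m))

maxDegree : ∀ {m} → Graph m → ℕ
maxDegree {m} G = foldr _⊔_ 0 (map (degree G) (allFin m))

-- A Hamiltonian cycle on Fin m: an ordering v_0 … v_{m-1} of all the vertices
-- (a bijection Fin m → Fin m), a cycle needing at least 3 vertices.
record HamCycle (m : ℕ) : Set where
  field
    three≤m : 3 ≤ m
    vtx     : Fin m → Fin m
    vtx-inj : Injective _≡_ _≡_ vtx
    vtx-sur : ∀ v → ∃ λ i → vtx i ≡ v
open HamCycle public

cycDist : ∀ {m} → Fin m → Fin m → ℕ
cycDist {m} i j = d ⊓ (m ∸ d)
  where d = (toℕ i ∸ toℕ j) ⊔ (toℕ j ∸ toℕ i)

PowEdge : ∀ {m} → HamCycle m → ℕ → Fin m → Fin m → Set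
PowEdge H p u v =
  Σ _ λ i → Σ _ λ j → vtx H i ≡ u × vtx H j ≡ v × u ≢ v × cycDist i j ≤ p

PowSubgraph : ∀ {m} → HamCycle m → ℕ → Graph m → Set
PowSubgraph H p G = ∀ u v → PowEdge H p u v → adj G u v ≡ true

IsClique : ∀ {m ℓ} → (Fin m → Fin m → Set) → (Fin ℓ → Fin m) → Set
IsClique J a = Injective _≡_ _≡_ a × (∀ i j → i ≢ j → J (a i) (a j))

AltBag : ∀ {m} → (Fin m → Fin m → Set) → ℕ → Graph m → Graph m → Set
AltBag {m} J ℓ G2 G3 =
  Σ (Fin ℓ → Fin m) λ a1 → Σ (Fin ℓ → Fin m) λ a2 →
    IsClique J a1 × IsClique J a2 × (∀ i j → a1 i ≢ a2 j) ×
    Σ (Fin ℓ) λ i2 → Σ (Fin ℓ) λ j2 → Σ (Fin ℓ) λ i3 → Σ (Fin ℓ) λ j3 →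
      adj G2 (a1 i2) (a2 j2) ≡ true × adj G3 (a1 i3) (a2 j3) ≡ true ×
      a1 i2 ≢ a1 i3 × a1 i2 ≢ a2 j3 × a2 j2 ≢ a1 i3 × a2 j2 ≢ a2 j3

{-# OPTIONS --safe #-}

-- Put h = ℓ - 1, D = Δ₂Δ₃ and R = m - δ₁.  Arrange some of the vertices cyclically without conflict:
-- vertices at cyclic distance at most h are adjacent in G1, and there are no near pairs x x′ and y y′
-- with xy ∈ E₂ and x′y′ ∈ E₃.  A new vertex v can conflict with x only if they are linked, that is,
-- non-adjacent in G1 or joined by a chain v -E₂- y, y near z, z -E₃- x (or the same with E₂ and E₃
-- swapped); a vertex has at most 4hD + R < Λ links.  Among the conflict-free arrangements take one with
-- the number t of placed vertices maximal and, subject to this, with a potential Φ maximal that counts the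
-- links inside the set U of unplaced vertices.  Suppose U ≠ ∅.
--
-- Every v ∈ U has a linked vertex in each window of 2h consecutive placed vertices.  Double counting the
-- links between U and the placed vertices gives |U| ≤ 2h(2hD + R).  If v has k(v) placed links, at least
-- 2t/h - 3k(v) - 2D of the linked vertices are far from all the others and not adjacent to v, and v can be
-- exchanged for any of them without conflict; since Φ is maximal, each of these has at most Λ - k(v) links
-- into U.  Giving each such pair the weight 1/(Λ - k(v)), every placed vertex receives at most 1, so
-- Σ_{v ∈ U} (2t/h - 3k(v) - 2D)/(Λ - k(v)) ≤ t, which is impossible when m > 2hΛ + 4hD.
module Submission where

open import Defs renaming (sym to adj-sym)
open import Data.Nat using (ℕ; zero; suc; _+_; _*_; _∸_; _⊓_; _⊔_; _!; _≤_; _<_; z≤n; s≤s; NonZero; >-nonZero; _≟_; _≤?_; _<?_)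
open import Data.Nat.DivMod using (_/_; _%_; m≡m%n+[m/n]*n; m%n<n; m<n⇒m%n≡m; [m+n]%n≡m%n; %-distribˡ-+; m/n*n≡m)
open import Data.Nat.Divisibility using (∣-trans; m∣m*n; m≤n⇒m!∣n!)
open import Data.Nat.ListAction using (sum)
open import Data.Nat.Properties
open import Data.Nat.Tactic.RingSolver using (solve-∀)
open import Data.Bool using (true; false; if_then_else_)
open import Data.Empty using (⊥; ⊥-elim)
open import Data.Fin using (Fin; zero; toℕ; fromℕ<)
open import Data.Fin.Properties using (toℕ<n; toℕ-injective; toℕ-fromℕ<) renaming (_≟_ to _≟ᶠ_)
open import Data.List using (List; []; _∷_; _++_; map; foldr; length; allFin; downFrom; concatMap; cartesianProduct)
open import Data.List.Properties using (length-downFrom; length-tabulate)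
open import Data.List.Membership.Propositional using (_∈_; find; lose)
open import Data.List.Membership.Propositional.Properties using (∈-downFrom⁺; ∈-downFrom⁻; ∈-allFin; ∈-map⁺; ∈-cartesianProduct⁺)
open import Data.List.Relation.Unary.All as All using (All; []; _∷_)
open import Data.List.Relation.Unary.AllPairs using (_∷_)
open import Data.List.Relation.Unary.Any using (here; there; any?)
open import Data.List.Relation.Unary.Unique.Propositional using (Unique)
open import Data.List.Relation.Unary.Unique.Propositional.Properties using (allFin⁺)
open import Data.Product using (Σ; ∃; ∃₂; _×_; _,_; proj₁; proj₂)
open import Data.Sum using (_⊎_; inj₁; inj₂; swap)
open import Function using (_∘_)
open import Relation.Binary.Definitions using (tri<; tri≈; tri>)
open import Relation.Binary.PropositionalEquality
open import Relation.Nullary using (Dec; yes; no; ¬_; does; _×-dec_)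
open import Relation.Nullary.Decidable using (map′)

-- Finite sums over lists

private variable A B : Set

∑ : List A → (A → ℕ) → ℕ
∑ []       f = 0
∑ (x ∷ xs) f = f x + ∑ xs f

∑≡sum : ∀ (xs : List A) (f : A → ℕ) → ∑ xs f ≡ sum (map f xs)
∑≡sum []       f = refl
∑≡sum (x ∷ xs) f = cong (f x +_) (∑≡sum xs f)

∑-mono-∈ : ∀ (xs : List A) {f g : A → ℕ} → (∀ {x} → x ∈ xs → f x ≤ g x) → ∑ xs f ≤ ∑ xs g
∑-mono-∈ []       f≤g = z≤n
∑-mono-∈ (x ∷ xs) f≤g = +-mono-≤ (f≤g (here refl)) (∑-mono-∈ xs (f≤g ∘ there))

∑-mono : ∀ (xs : List A) {f g : A → ℕ} → (∀ x → f x ≤ g x) → ∑ xs f ≤ ∑ xs g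
∑-mono xs f≤g = ∑-mono-∈ xs (λ {x} _ → f≤g x)

∑-cong-∈ : ∀ (xs : List A) {f g : A → ℕ} → (∀ {x} → x ∈ xs → f x ≡ g x) → ∑ xs f ≡ ∑ xs g
∑-cong-∈ []       f≡g = refl
∑-cong-∈ (x ∷ xs) f≡g = cong₂ _+_ (f≡g (here refl)) (∑-cong-∈ xs (f≡g ∘ there))

∑-cong : ∀ (xs : List A) {f g : A → ℕ} → (∀ x → f x ≡ g x) → ∑ xs f ≡ ∑ xs g
∑-cong xs f≡g = ∑-cong-∈ xs (λ {x} _ → f≡g x)

∑-+ : ∀ (xs : List A) (f g : A → ℕ) → ∑ xs (λ x → f x + g x) ≡ ∑ xs f + ∑ xs g
∑-+ []       f g = refl
∑-+ (x ∷ xs) f g = trans (cong (f x + g x +_) (∑-+ xs f g)) (lem (f x) (g x) (∑ xs f) (∑ xs g))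
  where
  lem : ∀ a b c d → a + b + (c + d) ≡ a + c + (b + d)
  lem = solve-∀

∑-*ˡ : ∀ (xs : List A) k (f : A → ℕ) → ∑ xs (λ x → k * f x) ≡ k * ∑ xs f
∑-*ˡ []       k f = sym (*-zeroʳ k)
∑-*ˡ (x ∷ xs) k f = trans (cong (k * f x +_) (∑-*ˡ xs k f)) (sym (*-distribˡ-+ k (f x) _))

∑-*ʳ : ∀ (xs : List A) (f : A → ℕ) k → ∑ xs (λ x → f x * k) ≡ ∑ xs f * k
∑-*ʳ xs f k = trans (∑-cong xs (λ x → *-comm (f x) k)) (trans (∑-*ˡ xs k f) (*-comm k _))

∑-const : ∀ (xs : List A) k → ∑ xs (λ _ → k) ≡ length xs * k
∑-const []       k = refl
∑-const (x ∷ xs) k = cong (k +_) (∑-const xs k)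

∑-swap : ∀ (xs : List A) (ys : List B) (f : A → B → ℕ) →
         ∑ xs (λ x → ∑ ys (f x)) ≡ ∑ ys (λ y → ∑ xs (λ x → f x y))
∑-swap []       ys f = sym (trans (∑-const ys 0) (*-zeroʳ (length ys)))
∑-swap (x ∷ xs) ys f = trans (cong (∑ ys (f x) +_) (∑-swap xs ys f)) (sym (∑-+ ys (f x) _))

∑-++ : ∀ (xs ys : List A) (f : A → ℕ) → ∑ (xs ++ ys) f ≡ ∑ xs f + ∑ ys f
∑-++ []       ys f = refl
∑-++ (x ∷ xs) ys f = trans (cong (f x +_) (∑-++ xs ys f)) (sym (+-assoc (f x) _ _))

∑-concatMap : ∀ (g : A → List B) (xs : List A) (f : B → ℕ) →
              ∑ (concatMap g xs) f ≡ ∑ xs (λ x → ∑ (g x) f)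
∑-concatMap g []       f = refl
∑-concatMap g (x ∷ xs) f =
  trans (∑-++ (g x) (concatMap g xs) f) (cong (∑ (g x) f +_) (∑-concatMap g xs f))

∑-term : ∀ {xs : List A} (f : A → ℕ) {x} → x ∈ xs → f x ≤ ∑ xs f
∑-term f (here refl)        = m≤m+n _ _
∑-term f (there {x = y} x∈) = ≤-trans (∑-term f x∈) (m≤n+m _ (f y))

∑-two-terms : ∀ {xs : List A} (f : A → ℕ) {x y} → x ∈ xs → y ∈ xs → x ≢ y → f x + f y ≤ ∑ xs f
∑-two-terms f (here refl) (here refl) x≢y = ⊥-elim (x≢y refl)
∑-two-terms f (here refl) (there y∈)  x≢y = +-monoʳ-≤ _ (∑-term f y∈)
∑-two-terms f {x} {y} (there x∈) (here refl) x≢y =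
  ≤-trans (≤-reflexive (+-comm (f x) (f y))) (+-monoʳ-≤ (f y) (∑-term f x∈))
∑-two-terms f (there {x = z} x∈) (there y∈) x≢y =
  ≤-trans (∑-two-terms f x∈ y∈ x≢y) (m≤n+m _ (f z))

∑≥1⇒∃ : ∀ (xs : List A) (f : A → ℕ) → 1 ≤ ∑ xs f → ∃ λ x → x ∈ xs × 1 ≤ f x
∑≥1⇒∃ (x ∷ xs) f 1≤ with f x in eq
... | suc n = x , here refl , subst (1 ≤_) (sym eq) (s≤s z≤n)
... | zero  with ∑≥1⇒∃ xs f 1≤
...   | y , y∈ , 1≤fy = y , there y∈ , 1≤fy

∑≡0⇒ : ∀ {xs : List A} (f : A → ℕ) → ∑ xs f ≡ 0 → ∀ {x} → x ∈ xs → f x ≡ 0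
∑≡0⇒ f ≡0 x∈ = n≤0⇒n≡0 (subst (_ ≤_) ≡0 (∑-term f x∈))

-- The Kronecker delta as an indicator function

δ : ∀ {m} → Fin m → Fin m → ℕ
δ a b = if does (a ≟ᶠ b) then 1 else 0

δ-refl : ∀ {m} (a : Fin m) → δ a a ≡ 1
δ-refl a with a ≟ᶠ a
... | yes _  = refl
... | no a≢a = ⊥-elim (a≢a refl)

δ-≢ : ∀ {m} {a b : Fin m} → a ≢ b → δ a b ≡ 0
δ-≢ {a = a} {b} a≢b with a ≟ᶠ b
... | yes a≡b = ⊥-elim (a≢b a≡b)
... | no _    = refl

-- Only one term survives because `allFin m` lists `a` exactly once: uniqueness makes all other
-- terms vanish.
∑-δ : ∀ {m} (a : Fin m) (f : Fin m → ℕ) → ∑ (allFin m) (λ v → δ a v * f v) ≡ f a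
∑-δ a f = go (allFin⁺ _) (∈-allFin a)
  where
  absent : ∀ {xs} → All (a ≢_) xs → ∑ xs (λ v → δ a v * f v) ≡ 0
  absent []         = refl
  absent (a≢ ∷ as) rewrite δ-≢ a≢ = absent as
  go : ∀ {xs} → Unique xs → a ∈ xs → ∑ xs (λ v → δ a v * f v) ≡ f a
  go (x≢ ∷ _) (here refl) rewrite δ-refl a =
    trans (cong₂ _+_ (*-identityˡ (f a)) (absent x≢)) (+-identityʳ (f a))
  go (x≢ ∷ u) (there a∈) rewrite δ-≢ (All.lookup x≢ a∈ ∘ sym) = go u a∈

length-allFin : ∀ m → length (allFin m) ≡ m
length-allFin m = length-tabulate {n = m} (λ i → i)

-- Sums of periodic sequences

∑-range : ∀ n (f : ℕ → ℕ) → ∑ (downFrom (suc n)) f ≡ ∑ (downFrom n) (f ∘ suc) + f 0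
∑-range zero    f = +-comm (f 0) 0
∑-range (suc n) f = trans (cong (f (suc n) +_) (∑-range n f)) (sym (+-assoc (f (suc n)) _ _))

-- A shift by one drops the term at 0 and adds the term at `t`, and these agree by periodicity.
-- `∑-range` exposes the former, `downFrom` itself the latter.
∑-shift : ∀ t (f : ℕ → ℕ) → (∀ i → f (i + t) ≡ f i) → ∀ r →
          ∑ (downFrom t) (λ i → f (i + r)) ≡ ∑ (downFrom t) f
∑-shift t f per zero    = ∑-cong (downFrom t) (λ i → cong f (+-identityʳ i))
∑-shift t f per (suc r) = begin
  ∑ (downFrom t) (λ i → f (i + suc r)) ≡⟨ ∑-cong (downFrom t) (λ i → cong f (+-suc i r)) ⟩
  ∑ (downFrom t) (g ∘ suc)             ≡⟨ +-cancelʳ-≡ (g 0) _ _ step ⟩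
  ∑ (downFrom t) g                     ≡⟨ ∑-shift t f per r ⟩
  ∑ (downFrom t) f                     ∎
  where
  open ≡-Reasoning
  g : ℕ → ℕ
  g i = f (i + r)
  step : ∑ (downFrom t) (g ∘ suc) + g 0 ≡ ∑ (downFrom t) g + g 0
  step = begin
    ∑ (downFrom t) (g ∘ suc) + g 0 ≡⟨ ∑-range t g ⟨
    g t + ∑ (downFrom t) g         ≡⟨ cong (_+ ∑ (downFrom t) g) (trans (cong f (+-comm t r)) (per r)) ⟩
    g 0 + ∑ (downFrom t) g         ≡⟨ +-comm (g 0) _ ⟩
    ∑ (downFrom t) g + g 0         ∎

-- Each position of the period is met by `n` of the `t` windows of length `n`.
∑-double-shift : ∀ t n (f : ℕ → ℕ) → (∀ i → f (i + t) ≡ f i) → ∀ s →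
  ∑ (downFrom t) (λ j → ∑ (downFrom n) (λ r → f (j + (r + s)))) ≡ n * ∑ (downFrom t) f
∑-double-shift t n f per s = begin
  ∑ (downFrom t) (λ j → ∑ (downFrom n) (λ r → f (j + (r + s)))) ≡⟨ ∑-swap (downFrom t) (downFrom n) _ ⟩
  ∑ (downFrom n) (λ r → ∑ (downFrom t) (λ j → f (j + (r + s)))) ≡⟨ ∑-cong (downFrom n) (λ r → ∑-shift t f per (r + s)) ⟩
  ∑ (downFrom n) (λ r → ∑ (downFrom t) f)                       ≡⟨ ∑-const (downFrom n) _ ⟩
  length (downFrom n) * ∑ (downFrom t) f                        ≡⟨ cong (_* _) (length-downFrom n) ⟩
  n * ∑ (downFrom t) f                                          ∎
  where open ≡-Reasoning

-- Isolated marks in a periodic sequence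

module Spacing (t h : ℕ) (X : ℕ → ℕ) (per : ∀ i → X (i + t) ≡ X i)
               (hit : ∀ {j} → j < t → ∃ λ r → r < h + h × 1 ≤ X (j + r)) where

  clearʳ clearˡ : ℕ → ℕ
  clearʳ i = 1 ∸ ∑ (downFrom h) (λ s → X (i + suc s))
  -- This is about the position i + h, which avoids subtraction.
  clearˡ i = 1 ∸ ∑ (downFrom h) (λ s → X (i + s))

  private
    f g : ℕ → ℕ
    f i = X i * (1 + clearʳ i)
    g i = X (i + h) * (1 + clearˡ i)

    per-∑ : ∀ (i : ℕ) (k : ℕ → ℕ) → ∑ (downFrom h) (λ s → X (i + t + k s)) ≡ ∑ (downFrom h) (λ s → X (i + k s))
    per-∑ i k = ∑-cong (downFrom h) λ s → trans (cong X (lem i t (k s))) (per _)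
      where
      lem : ∀ i t s → i + t + s ≡ i + s + t
      lem = solve-∀

    f-per : ∀ i → f (i + t) ≡ f i
    f-per i = cong₂ (λ x y → x * (1 + (1 ∸ y))) (per i) (per-∑ i suc)

    g-per : ∀ i → g (i + t) ≡ g i
    g-per i = cong₂ (λ x y → x * (1 + (1 ∸ y))) (trans (cong X (lem i t h)) (per _)) (per-∑ i (λ s → s))
      where
      lem : ∀ i t s → i + t + s ≡ i + s + t
      lem = solve-∀

    -- A window of length 2h, with its first half weighted by `f` and its second half by `g`. The
    -- `h` positions inspected by `clearʳ` or `clearˡ` then stay inside the window. The `+ 0` fits
    -- the form of `∑-double-shift`.
    window : ℕ → ℕ
    window j = ∑ (downFrom h) (λ r → f (j + (r + 0))) + ∑ (downFrom h) (λ r → g (j + (r + 0)))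

    f-term : ∀ j {r} → r < h → f (j + r) ≤ ∑ (downFrom h) (λ r → f (j + (r + 0)))
    f-term j {r} r<h = subst (λ z → f (j + z) ≤ _) (+-identityʳ r)
      (∑-term (λ r → f (j + (r + 0))) (∈-downFrom⁺ r<h))

    g-term : ∀ j {r} → r < h → g (j + r) ≤ ∑ (downFrom h) (λ r → g (j + (r + 0)))
    g-term j {r} r<h = subst (λ z → g (j + z) ≤ _) (+-identityʳ r)
      (∑-term (λ r → g (j + (r + 0))) (∈-downFrom⁺ r<h))

    f≥1 : ∀ {i} → 1 ≤ X i → 1 ≤ f i
    f≥1 1≤X = *-mono-≤ 1≤X (s≤s z≤n)

    g≥1 : ∀ {i} → 1 ≤ X (i + h) → 1 ≤ g i
    g≥1 1≤X = *-mono-≤ 1≤X (s≤s z≤n)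

    split : ∀ {r} → r < h + h → r < h ⊎ ∃ λ r' → r' < h × r ≡ r' + h
    split {r} r<2h with r <? h
    ... | yes r<h = inj₁ r<h
    ... | no r≮h  = inj₂ (r ∸ h , +-cancelʳ-< h _ _ (subst (_< h + h) (sym (m∸n+n≡m (≮⇒≥ r≮h))) r<2h)
                               , sym (m∸n+n≡m (≮⇒≥ r≮h)))

    two : ∀ j {r r'} → r < h + h → r' < h + h → r ≢ r' → 1 ≤ X (j + r) → 1 ≤ X (j + r') → 2 ≤ window j
    two j {r} {r'} r< r'< r≢r' Xr Xr' with split r< | split r'<
    ... | inj₁ r<h | inj₁ r'<h = ≤-trans
          (+-mono-≤ (f≥1 (subst (λ z → 1 ≤ X (j + z)) (sym (+-identityʳ r)) Xr))
                    (f≥1 (subst (λ z → 1 ≤ X (j + z)) (sym (+-identityʳ r')) Xr')))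
          (≤-trans (∑-two-terms (λ r → f (j + (r + 0))) (∈-downFrom⁺ r<h) (∈-downFrom⁺ r'<h) r≢r') (m≤m+n _ _))
    ... | inj₁ r<h | inj₂ (s' , s'<h , refl) =
          +-mono-≤ (≤-trans (f≥1 Xr) (f-term j r<h))
                   (≤-trans (g≥1 (subst (λ z → 1 ≤ X z) (sym (+-assoc j s' h)) Xr')) (g-term j s'<h))
    ... | inj₂ (s , s<h , refl) | inj₁ r'<h =
          +-mono-≤ (≤-trans (f≥1 Xr') (f-term j r'<h))
                   (≤-trans (g≥1 (subst (λ z → 1 ≤ X z) (sym (+-assoc j s h)) Xr)) (g-term j s<h))
    ... | inj₂ (s , s<h , refl) | inj₂ (s' , s'<h , refl) = ≤-trans
          (+-mono-≤ (g≥1 (subst (λ z → 1 ≤ X z) (lem j s h) Xr))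
                    (g≥1 (subst (λ z → 1 ≤ X z) (lem j s' h) Xr')))
          (≤-trans (∑-two-terms (λ r → g (j + (r + 0))) (∈-downFrom⁺ s<h) (∈-downFrom⁺ s'<h) (r≢r' ∘ cong (_+ h)))
                   (m≤n+m _ _))
      where
      lem : ∀ j s h → j + (s + h) ≡ j + (s + 0) + h
      lem = solve-∀

    -- An isolated marked position counts twice, and otherwise the window has two marked positions.
    window≥2 : ∀ {j} → j < t → 2 ≤ window j
    window≥2 {j} j<t with hit j<t
    ... | r , r< , Xr with split r<
    ...   | inj₁ r<h = case
      where
      case : 2 ≤ window j
      case with ∑ (downFrom h) (λ s → X (j + r + suc s)) in eq
      ... | zero  = ≤-trans (subst (2 ≤_) (cong (λ z → X (j + r) * (1 + (1 ∸ z))) (sym eq))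
                      (*-monoˡ-≤ 2 Xr)) (≤-trans (f-term j r<h) (m≤m+n _ _))
      ... | suc _ with ∑≥1⇒∃ (downFrom h) _ (subst (1 ≤_) (sym eq) (s≤s z≤n))
      ...   | s , s∈ , Xs = two j r< (+-mono-<-≤ r<h (∈-downFrom⁻ s∈)) (<⇒≢ (m<m+n r (s≤s z≤n))) Xr
                (subst (λ z → 1 ≤ X z) (+-assoc j r (suc s)) Xs)
    window≥2 {j} j<t | _ , r< , Xr | inj₂ (r , r<h , refl) = case
      where
      case : 2 ≤ window j
      case with ∑ (downFrom h) (λ s → X (j + r + s)) in eq
      ... | zero  = ≤-trans (subst (2 ≤_) (cong₂ (λ x z → X x * (1 + (1 ∸ z))) (sym (+-assoc j r h)) (sym eq))
                      (*-monoˡ-≤ 2 Xr)) (≤-trans (g-term j r<h) (m≤n+m _ _))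
      ... | suc _ with ∑≥1⇒∃ (downFrom h) _ (subst (1 ≤_) (sym eq) (s≤s z≤n))
      ...   | s , s∈ , Xs = two j r< (+-mono-< r<h (∈-downFrom⁻ s∈)) (<⇒≢ (+-monoʳ-< r (∈-downFrom⁻ s∈)) ∘ sym) Xr
                (subst (λ z → 1 ≤ X z) (+-assoc j r s) Xs)

  -- Summing `window≥2` over the `t` windows counts every position `h` times through `f` and `h`
  -- times through `g`. For a, b in {0, 1} one has (1 + a) + (1 + b) ≤ 3 + ab, so only a mark that
  -- is clear on both sides counts more than 3. If `X` takes the values 0 and 1, there are at least
  -- 2t/h minus three times the number of marks of these.
  spacing : t * 2 ≤ h * ∑ (downFrom t) (λ i → X (i + h) * (3 + clearʳ (i + h) * clearˡ i))
  spacing = begin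
    t * 2                                             ≡⟨ cong (_* 2) (length-downFrom t) ⟨
    length (downFrom t) * 2                           ≡⟨ ∑-const (downFrom t) 2 ⟨
    ∑ (downFrom t) (λ _ → 2)                          ≤⟨ ∑-mono-∈ (downFrom t) (λ j∈ → window≥2 (∈-downFrom⁻ j∈)) ⟩
    ∑ (downFrom t) window                             ≡⟨ ∑-+ (downFrom t) _ _ ⟩
    _                                                 ≡⟨ cong₂ _+_ (∑-double-shift t h f f-per 0) (∑-double-shift t h g g-per 0) ⟩
    h * ∑ (downFrom t) f + h * ∑ (downFrom t) g       ≡⟨ *-distribˡ-+ h _ _ ⟨
    -- The shift by `h` makes `f (i + h)` and `g i` speak of the same position `i + h`.
    h * (∑ (downFrom t) f + ∑ (downFrom t) g)         ≡⟨ cong (λ z → h * (z + ∑ (downFrom t) g)) (∑-shift t f f-per h) ⟨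
    h * (∑ (downFrom t) (λ i → f (i + h)) + ∑ (downFrom t) g) ≡⟨ cong (h *_) (∑-+ (downFrom t) _ g) ⟨
    h * ∑ (downFrom t) (λ i → f (i + h) + g i)        ≤⟨ *-monoʳ-≤ h (∑-mono (downFrom t) pointwise) ⟩
    _ ∎
    where
    open ≤-Reasoning
    clear≤1 : ∀ n → 1 ∸ n ≡ 0 ⊎ 1 ∸ n ≡ 1
    clear≤1 zero    = inj₂ refl
    clear≤1 (suc n) = inj₁ (0∸n≡0 n)
    pointwise : ∀ i → f (i + h) + g i ≤ X (i + h) * (3 + clearʳ (i + h) * clearˡ i)
    pointwise i rewrite sym (*-distribˡ-+ (X (i + h)) (1 + clearʳ (i + h)) (1 + clearˡ i))
      with clear≤1 (∑ (downFrom h) (λ s → X (i + h + suc s))) | clear≤1 (∑ (downFrom h) (λ s → X (i + s)))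
    ... | inj₁ a | inj₁ b rewrite a | b = *-monoʳ-≤ (X (i + h)) (s≤s (s≤s z≤n))
    ... | inj₁ a | inj₂ b rewrite a | b = ≤-refl
    ... | inj₂ a | inj₁ b rewrite a | b = ≤-refl
    ... | inj₂ a | inj₂ b rewrite a | b = ≤-refl

-- Partial arrangements, links and the potential

-- A partial cyclic arrangement: a t-periodic sequence c in which every vertex occurs at most once
-- per period, ω being the indicator function of the vertices that do not occur.
record Arrangement (m : ℕ) : Set where
  field
    t    : ℕ
    t≥1  : 1 ≤ t
    c    : ℕ → Fin m
    per  : ∀ i → c (i + t) ≡ c i
    ω    : Fin m → ℕ
    part : ∀ v → ∑ (downFrom t) (λ i → δ (c i) v) + ω v ≡ 1

-- In the application `e₂` and `e₃` are the indicator functions of E₂ and E₃, and `rd` is that of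
-- non-adjacency in G1. The latter includes the diagonal, so that R = m - δ₁ bounds its row sums.
module Weights {m : ℕ} (h Δ₂ Δ₃ R : ℕ) (e₂ e₃ rd : Fin m → Fin m → ℕ)
  (sym₂ : ∀ a b → e₂ a b ≡ e₂ b a) (sym₃ : ∀ a b → e₃ a b ≡ e₃ b a) (symʳ : ∀ a b → rd a b ≡ rd b a)
  (irr₂ : ∀ a → e₂ a a ≡ 0) (irr₃ : ∀ a → e₃ a a ≡ 0)
  (deg₂ : ∀ a → ∑ (allFin m) (e₂ a) ≤ Δ₂) (deg₃ : ∀ a → ∑ (allFin m) (e₃ a) ≤ Δ₃)
  (degʳ : ∀ a → ∑ (allFin m) (rd a) ≤ R) where

  V : List (Fin m)
  V = allFin m

  -- Both orders are listed since the E₂-side and the E₃-side of a chain are distinguished. For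
  -- small `t` a pair of vertices may be listed repeatedly; in exchange every position has exactly
  -- 2h entries, as `near∑₁` and `near∑₂` use.
  nearIndices : ℕ → List (ℕ × ℕ)
  nearIndices t =
    concatMap (λ i → concatMap (λ r → (i , i + suc r) ∷ (i + suc r , i) ∷ []) (downFrom h)) (downFrom t)

  near∑ : ℕ → (ℕ → Fin m) → (Fin m → Fin m → ℕ) → ℕ
  near∑ t c f = ∑ (nearIndices t) (λ (i , j) → f (c i) (c j))

  near∑-def : ∀ t c f → near∑ t c f ≡
    ∑ (downFrom t) (λ i → ∑ (downFrom h) (λ r → f (c i) (c (i + suc r)) + f (c (i + suc r)) (c i)))
  near∑-def t c f =
    trans (∑-concatMap _ (downFrom t) _) (∑-cong (downFrom t) λ i →
    trans (∑-concatMap _ (downFrom h) _) (∑-cong (downFrom h) λ r →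
    cong (f (c i) (c (i + suc r)) +_) (+-identityʳ _)))

  -- With `ω` for `w` this is the number of unplaced neighbours of `y`; `τ`, `ω′` and the constant 1
  -- occur as weights too.
  wt : (Fin m → ℕ) → (Fin m → Fin m → ℕ) → Fin m → ℕ
  wt w e y = ∑ V (λ x → w x * e y x)

  chain : ℕ → (ℕ → Fin m) → Fin m → Fin m → ℕ
  chain t c a b = near∑ t c (λ y z → e₂ a y * e₃ b z + e₂ b y * e₃ a z)

  -- Bounds the number of conflicts that arise when a and b come near each other.
  μ : ℕ → (ℕ → Fin m) → Fin m → Fin m → ℕ
  μ t c a b = chain t c a b + rd a b

  μ-sym : ∀ t c a b → μ t c a b ≡ μ t c b a
  μ-sym t c a b = cong₂ _+_ (∑-cong (nearIndices t) λ (i , j) → +-comm (e₂ a (c i) * e₃ b (c j)) _) (symʳ a b)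

  -- The terms with Δ₂ and Δ₃ make up for the chains lost when a placed vertex in the middle of a chain
  -- is exchanged for an unplaced one.
  ρ : Fin m → Fin m → ℕ
  ρ a b = rd a b + (h + h) * (Δ₃ * e₂ a b + Δ₂ * e₃ a b)

  -- This is the sum of ω a · ω b · (chain a b + ρ a b) over all ordered pairs: a chain with both
  -- ends unplaced is read from either end, whence the factor 2.
  Φ : ℕ → (ℕ → Fin m) → (Fin m → ℕ) → ℕ
  Φ t c ω = 2 * near∑ t c (λ y z → wt ω e₂ y * wt ω e₃ z) + ∑ V (λ a → ω a * wt ω ρ a)

  -- Counting the chains from `v` by their middle pair instead of their far end makes each summand a
  -- product of two degrees.
  chain-wt : ∀ t c w v → ∑ V (λ x → w x * chain t c v x) ≡ near∑ t c (λ y z → e₂ v y * wt w e₃ z + wt w e₂ y * e₃ v z)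
  chain-wt t c w v = begin
    ∑ V (λ x → w x * chain t c v x)
      ≡⟨ ∑-cong V (λ x → sym (∑-*ˡ (nearIndices t) (w x) _)) ⟩
    ∑ V (λ x → ∑ (nearIndices t) (λ (i , j) → w x * (e₂ v (c i) * e₃ x (c j) + e₂ x (c i) * e₃ v (c j))))
      ≡⟨ ∑-swap V (nearIndices t) _ ⟩
    ∑ (nearIndices t) (λ (i , j) → ∑ V (λ x → w x * (e₂ v (c i) * e₃ x (c j) + e₂ x (c i) * e₃ v (c j))))
      ≡⟨ ∑-cong (nearIndices t) (λ (i , j) → inner (c i) (c j)) ⟩
    near∑ t c (λ y z → e₂ v y * wt w e₃ z + wt w e₂ y * e₃ v z) ∎
    where
    open ≡-Reasoning
    distrib : ∀ a b c d e → a * (b * c + d * e) ≡ b * (a * c) + a * d * e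
    distrib = solve-∀
    inner : ∀ y z → ∑ V (λ x → w x * (e₂ v y * e₃ x z + e₂ x y * e₃ v z)) ≡ e₂ v y * wt w e₃ z + wt w e₂ y * e₃ v z
    inner y z = begin
      ∑ V (λ x → w x * (e₂ v y * e₃ x z + e₂ x y * e₃ v z))
        ≡⟨ ∑-cong V (λ x → trans (cong₂ (λ p q → w x * (e₂ v y * p + q * e₃ v z)) (sym₃ x z) (sym₂ x y))
                               (distrib (w x) (e₂ v y) (e₃ z x) (e₂ y x) (e₃ v z))) ⟩
      ∑ V (λ x → e₂ v y * (w x * e₃ z x) + w x * e₂ y x * e₃ v z)
        ≡⟨ ∑-+ V _ _ ⟩
      ∑ V (λ x → e₂ v y * (w x * e₃ z x)) + ∑ V (λ x → w x * e₂ y x * e₃ v z)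
        ≡⟨ cong₂ _+_ (∑-*ˡ V (e₂ v y) _) (∑-*ʳ V _ (e₃ v z)) ⟩
      e₂ v y * wt w e₃ z + wt w e₂ y * e₃ v z ∎

  μ-wt : ∀ t c w v → ∑ V (λ x → w x * μ t c v x) ≡
         near∑ t c (λ y z → e₂ v y * wt w e₃ z + wt w e₂ y * e₃ v z) + wt w rd v
  μ-wt t c w v = begin
    ∑ V (λ x → w x * μ t c v x)                             ≡⟨ ∑-cong V (λ x → *-distribˡ-+ (w x) _ _) ⟩
    ∑ V (λ x → w x * chain t c v x + w x * rd v x)          ≡⟨ ∑-+ V _ _ ⟩
    ∑ V (λ x → w x * chain t c v x) + wt w rd v             ≡⟨ cong (_+ wt w rd v) (chain-wt t c w v) ⟩
    _ ∎
    where open ≡-Reasoning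

  -- Double counting of links

  module Counting (P : Arrangement m) where
    open Arrangement P

    τ : Fin m → ℕ
    τ v = ∑ (downFrom t) (λ i → δ (c i) v)

    -- By `part`, `τ` is the indicator function of the placed vertices; so these count, with
    -- multiplicity, the links from `v` to placed and to unplaced vertices.
    k l : Fin m → ℕ
    k v = ∑ V (λ x → τ x * μ t c v x)
    l v = ∑ V (λ x → ω x * μ t c v x)

    ∑-placed : ∀ (g : Fin m → ℕ) → ∑ (downFrom t) (g ∘ c) ≡ ∑ V (λ v → τ v * g v)
    ∑-placed g = begin
      ∑ (downFrom t) (g ∘ c)                                 ≡⟨ ∑-cong (downFrom t) (λ i → sym (∑-δ (c i) g)) ⟩
      ∑ (downFrom t) (λ i → ∑ V (λ v → δ (c i) v * g v))     ≡⟨ ∑-swap (downFrom t) V _ ⟩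
      ∑ V (λ v → ∑ (downFrom t) (λ i → δ (c i) v * g v))     ≡⟨ ∑-cong V (λ v → ∑-*ʳ (downFrom t) _ (g v)) ⟩
      ∑ V (λ v → τ v * g v) ∎
      where open ≡-Reasoning

    ∑-split : ∀ (g : Fin m → ℕ) → ∑ V (λ v → τ v * g v) + ∑ V (λ v → ω v * g v) ≡ ∑ V g
    ∑-split g = trans (sym (∑-+ V _ _)) (∑-cong V λ v →
      trans (sym (*-distribʳ-+ (g v) (τ v) (ω v))) (trans (cong (_* g v) (part v)) (*-identityˡ (g v))))

    wt-split : ∀ e y → wt τ e y + wt ω e y ≡ ∑ V (e y)
    wt-split e y = ∑-split (e y)

    placed+unplaced : t + ∑ V ω ≡ m
    placed+unplaced = begin
      t + ∑ V ω                                       ≡⟨ cong₂ _+_ t≡ (∑-cong V (λ v → sym (*-identityʳ (ω v)))) ⟩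
      ∑ V (λ v → τ v * 1) + ∑ V (λ v → ω v * 1)       ≡⟨ ∑-split (λ _ → 1) ⟩
      ∑ V (λ _ → 1)                                   ≡⟨ ∑-const V 1 ⟩
      length V * 1                                    ≡⟨ *-identityʳ _ ⟩
      length V                                        ≡⟨ length-allFin m ⟩
      m                                               ∎
      where
      open ≡-Reasoning
      t≡ : t ≡ ∑ V (λ v → τ v * 1)
      t≡ = begin
        t                           ≡⟨ length-downFrom t ⟨
        length (downFrom t)         ≡⟨ *-identityʳ _ ⟨
        length (downFrom t) * 1     ≡⟨ ∑-const (downFrom t) 1 ⟨
        ∑ (downFrom t) (λ _ → 1)    ≡⟨ ∑-placed (λ _ → 1) ⟩
        ∑ V (λ v → τ v * 1)         ∎

    placed-shift : ∀ (g : Fin m → ℕ) r → ∑ (downFrom t) (λ i → g (c (i + r))) ≡ ∑ V (λ v → τ v * g v)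
    placed-shift g r = trans (∑-shift t (g ∘ c) (cong g ∘ per) r) (∑-placed g)

    private
      firsts : ∀ (g : Fin m → ℕ) → ∑ (downFrom t) (λ i → ∑ (downFrom h) (λ _ → g (c i))) ≡ h * ∑ V (λ v → τ v * g v)
      firsts g = begin
        ∑ (downFrom t) (λ i → ∑ (downFrom h) (λ _ → g (c i))) ≡⟨ ∑-cong (downFrom t) (λ i → ∑-const (downFrom h) _) ⟩
        ∑ (downFrom t) (λ i → length (downFrom h) * g (c i))  ≡⟨ ∑-*ˡ (downFrom t) (length (downFrom h)) (g ∘ c) ⟩
        length (downFrom h) * ∑ (downFrom t) (g ∘ c)          ≡⟨ cong₂ _*_ (length-downFrom h) (∑-placed g) ⟩
        h * ∑ V (λ v → τ v * g v) ∎
        where open ≡-Reasoning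
      seconds : ∀ (g : Fin m → ℕ) → ∑ (downFrom t) (λ i → ∑ (downFrom h) (λ r → g (c (i + suc r)))) ≡ h * ∑ V (λ v → τ v * g v)
      seconds g = begin
        ∑ (downFrom t) (λ i → ∑ (downFrom h) (λ r → g (c (i + suc r))))
          ≡⟨ ∑-cong (downFrom t) (λ i → ∑-cong (downFrom h) λ r → cong (λ z → g (c (i + z))) (+-comm 1 r)) ⟩
        ∑ (downFrom t) (λ i → ∑ (downFrom h) (λ r → g (c (i + (r + 1)))))
          ≡⟨ ∑-double-shift t h (g ∘ c) (cong g ∘ per) 1 ⟩
        h * ∑ (downFrom t) (g ∘ c)
          ≡⟨ cong (h *_) (∑-placed g) ⟩
        h * ∑ V (λ v → τ v * g v) ∎
        where open ≡-Reasoning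
      split-sum : ∀ (f g : ℕ → ℕ → ℕ) → ∑ (downFrom t) (λ i → ∑ (downFrom h) (λ r → f i r + g i r)) ≡
                  ∑ (downFrom t) (λ i → ∑ (downFrom h) (f i)) + ∑ (downFrom t) (λ i → ∑ (downFrom h) (g i))
      split-sum f g = trans (∑-cong (downFrom t) λ i → ∑-+ (downFrom h) (f i) (g i)) (∑-+ (downFrom t) _ _)

    -- Every position is the first entry of 2h of the listed pairs: `h` ahead of it and `h` behind
    -- it.
    near∑₁ : ∀ (g : Fin m → ℕ) → near∑ t c (λ y _ → g y) ≡ (h + h) * ∑ V (λ v → τ v * g v)
    near∑₁ g = trans (near∑-def t c (λ y _ → g y)) (trans (split-sum _ _)
      (trans (cong₂ _+_ (firsts g) (seconds g)) (sym (*-distribʳ-+ _ h h))))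

    near∑₂ : ∀ (g : Fin m → ℕ) → near∑ t c (λ _ z → g z) ≡ (h + h) * ∑ V (λ v → τ v * g v)
    near∑₂ g = trans (near∑-def t c (λ _ z → g z)) (trans (split-sum _ _)
      (trans (cong₂ _+_ (seconds g) (firsts g)) (sym (*-distribʳ-+ _ h h))))

    near∑-+ : ∀ f g → near∑ t c (λ y z → f y z + g y z) ≡ near∑ t c f + near∑ t c g
    near∑-+ f g = ∑-+ (nearIndices t) _ _

    near∑-mono : ∀ {f g} → (∀ y z → f y z ≤ g y z) → near∑ t c f ≤ near∑ t c g
    near∑-mono f≤g = ∑-mono (nearIndices t) (λ (i , j) → f≤g (c i) (c j))

    pull : ∀ (w : Fin m → ℕ) e a K → ∑ V (λ y → w y * (e a y * K)) ≡ wt w e a * K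
    pull w e a K = trans (∑-cong V (λ y → sym (*-assoc (w y) (e a y) K))) (∑-*ʳ V _ K)

    -- Pairing the two link counts with the degrees into the unplaced set makes the conflict graph
    -- behave like a fixed graph of maximum degree 4hΔ₂Δ₃ + R.
    links-bound : ∀ v → k v + l v + (h + h) * (Δ₃ * wt ω e₂ v + Δ₂ * wt ω e₃ v) ≤ 4 * h * (Δ₂ * Δ₃) + R
    links-bound v = begin
      k v + l v + E
        ≡⟨ cong (_+ E) (∑-split (μ t c v)) ⟩
      ∑ V (μ t c v) + E
        ≡⟨ cong (_+ E) (∑-cong V (λ x → sym (*-identityˡ _))) ⟩
      ∑ V (λ x → 1 * μ t c v x) + E
        ≡⟨ cong (_+ E) (μ-wt t c (λ _ → 1) v) ⟩
      near∑ t c (λ y z → e₂ v y * wt (λ _ → 1) e₃ z + wt (λ _ → 1) e₂ y * e₃ v z) + wt (λ _ → 1) rd v + E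
        ≤⟨ +-monoˡ-≤ E (+-mono-≤ (near∑-mono λ y z → +-mono-≤ (*-monoʳ-≤ (e₂ v y) (deg1 e₃ deg₃ z))
             (≤-trans (*-monoˡ-≤ (e₃ v z) (deg1 e₂ deg₂ y)) (≤-reflexive (*-comm Δ₂ _)))) (deg1 rd degʳ v)) ⟩
      near∑ t c (λ y z → e₂ v y * Δ₃ + e₃ v z * Δ₂) + R + E
        ≡⟨ cong (λ s → s + R + E) (trans (near∑-+ (λ y _ → e₂ v y * Δ₃) (λ _ z → e₃ v z * Δ₂)) (cong₂ _+_ (near∑₁ _) (near∑₂ _))) ⟩
      (h + h) * ∑ V (λ y → τ y * (e₂ v y * Δ₃)) + (h + h) * ∑ V (λ y → τ y * (e₃ v y * Δ₂)) + R + E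
        ≡⟨ cong₂ (λ p q → (h + h) * p + (h + h) * q + R + E) (pull τ e₂ v Δ₃) (pull τ e₃ v Δ₂) ⟩
      (h + h) * (wt τ e₂ v * Δ₃) + (h + h) * (wt τ e₃ v * Δ₂) + R + E
        ≡⟨ regroup h (wt τ e₂ v) (wt τ e₃ v) (wt ω e₂ v) (wt ω e₃ v) Δ₂ Δ₃ R ⟩
      (h + h) * (Δ₃ * (wt τ e₂ v + wt ω e₂ v) + Δ₂ * (wt τ e₃ v + wt ω e₃ v)) + R
        ≤⟨ +-monoˡ-≤ R (*-monoʳ-≤ (h + h) (+-mono-≤ (*-monoʳ-≤ Δ₃ (≤-trans (≤-reflexive (wt-split e₂ v)) (deg₂ v)))
                                                  (*-monoʳ-≤ Δ₂ (≤-trans (≤-reflexive (wt-split e₃ v)) (deg₃ v))))) ⟩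
      (h + h) * (Δ₃ * Δ₂ + Δ₂ * Δ₃) + R
        ≡⟨ fin h Δ₂ Δ₃ R ⟩
      4 * h * (Δ₂ * Δ₃) + R ∎
      where
      open ≤-Reasoning
      E = (h + h) * (Δ₃ * wt ω e₂ v + Δ₂ * wt ω e₃ v)
      deg1 : ∀ {Δ} e → (∀ a → ∑ V (e a) ≤ Δ) → ∀ y → wt (λ _ → 1) e y ≤ Δ
      deg1 e deg y = ≤-trans (≤-reflexive (∑-cong V (λ x → *-identityˡ _))) (deg y)
      regroup : ∀ h a b c d x y r →
        (h + h) * (a * y) + (h + h) * (b * x) + r + (h + h) * (y * c + x * d) ≡
        (h + h) * (y * (a + c) + x * (b + d)) + r
      regroup = solve-∀
      fin : ∀ h x y r → (h + h) * (y * x + x * y) + r ≡ 4 * h * (x * y) + r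
      fin = solve-∀

    -- Chains between an unplaced and a placed vertex are grouped by their middle pair (y, z). Both
    -- kinds together are part of the expanded product of the degrees of y in E₂ and z in E₃, hence
    -- at most Δ₂Δ₃, and there are 2ht middle pairs. This halves the 4h of `links-bound`. The
    -- non-adjacencies are counted from the placed side.
    unplaced-links : ∑ V (λ v → ω v * k v) ≤ t * ((h + h) * (Δ₂ * Δ₃) + R)
    unplaced-links = begin
      ∑ V (λ v → ω v * k v)
        ≡⟨ ∑-cong V (λ v → cong (ω v *_) (μ-wt t c τ v)) ⟩
      ∑ V (λ v → ω v * (near∑ t c (N v) + wt τ rd v))
        ≡⟨ trans (∑-cong V (λ v → *-distribˡ-+ (ω v) _ _)) (∑-+ V _ _) ⟩
      ∑ V (λ v → ω v * near∑ t c (N v)) + ∑ V (λ v → ω v * wt τ rd v)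
        ≡⟨ cong₂ _+_ chains reds ⟩
      near∑ t c (λ y z → wt ω e₂ y * wt τ e₃ z + wt τ e₂ y * wt ω e₃ z) + ∑ V (λ x → τ x * wt ω rd x)
        ≤⟨ +-mono-≤ (near∑-mono chain-le) (∑-mono V λ x → *-monoʳ-≤ (τ x)
             (≤-trans (m≤n+m _ (wt τ rd x)) (≤-trans (≤-reflexive (wt-split rd x)) (degʳ x)))) ⟩
      near∑ t c (λ _ _ → Δ₂ * Δ₃) + ∑ V (λ x → τ x * R)
        ≡⟨ cong (_+ ∑ V (λ x → τ x * R)) (near∑₁ (λ _ → Δ₂ * Δ₃)) ⟩
      (h + h) * ∑ V (λ x → τ x * (Δ₂ * Δ₃)) + ∑ V (λ x → τ x * R)
        ≡⟨ cong₂ (λ p q → (h + h) * p + q) (sum-τ (Δ₂ * Δ₃)) (sum-τ R) ⟩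
      (h + h) * (t * (Δ₂ * Δ₃)) + t * R
        ≡⟨ fin (h + h) t (Δ₂ * Δ₃) R ⟩
      t * ((h + h) * (Δ₂ * Δ₃) + R) ∎
      where
      open ≤-Reasoning
      N : Fin m → Fin m → Fin m → ℕ
      N v y z = e₂ v y * wt τ e₃ z + wt τ e₂ y * e₃ v z
      fin : ∀ n t d r → n * (t * d) + t * r ≡ t * (n * d + r)
      fin = solve-∀
      sum-τ : ∀ K → ∑ V (λ x → τ x * K) ≡ t * K
      sum-τ K = trans (sym (∑-placed (λ _ → K))) (trans (∑-const (downFrom t) K) (cong (_* K) (length-downFrom t)))
      distrib : ∀ w a b c d → w * (a * b + c * d) ≡ w * a * b + c * (w * d)
      distrib = solve-∀
      chains : ∑ V (λ v → ω v * near∑ t c (N v)) ≡ near∑ t c (λ y z → wt ω e₂ y * wt τ e₃ z + wt τ e₂ y * wt ω e₃ z)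
      chains = trans (∑-cong V (λ v → sym (∑-*ˡ (nearIndices t) (ω v) _)))
        (trans (∑-swap V (nearIndices t) _) (∑-cong (nearIndices t) λ (i , j) →
          trans (∑-cong V (λ v → trans (distrib (ω v) (e₂ v (c i)) (wt τ e₃ (c j)) (wt τ e₂ (c i)) (e₃ v (c j)))
                   (cong₂ (λ p q → ω v * p * wt τ e₃ (c j) + wt τ e₂ (c i) * (ω v * q)) (sym₂ v (c i)) (sym₃ v (c j)))))
          (trans (∑-+ V _ _) (cong₂ _+_ (∑-*ʳ V _ (wt τ e₃ (c j))) (∑-*ˡ V (wt τ e₂ (c i)) _)))))
      swap* : ∀ a b c → a * (b * c) ≡ b * (a * c)
      swap* = solve-∀
      reds : ∑ V (λ v → ω v * wt τ rd v) ≡ ∑ V (λ x → τ x * wt ω rd x)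
      reds = trans (∑-cong V (λ v → sym (∑-*ˡ V (ω v) _)))
        (trans (∑-swap V V _) (∑-cong V λ x →
          trans (∑-cong V (λ v → trans (swap* (ω v) (τ x) (rd v x)) (cong (λ z → τ x * (ω v * z)) (symʳ v x)))) (∑-*ˡ V (τ x) _)))
      expand : ∀ a b a' b' → (b + a) * (b' + a') ≡ a * b' + b * a' + (b * b' + a * a')
      expand = solve-∀
      chain-le : ∀ y z → wt ω e₂ y * wt τ e₃ z + wt τ e₂ y * wt ω e₃ z ≤ Δ₂ * Δ₃
      chain-le y z = ≤-trans (≤-trans (m≤m+n _ _)
          (≤-reflexive (sym (expand (wt ω e₂ y) (wt τ e₂ y) (wt ω e₃ z) (wt τ e₃ z)))))
        (*-mono-≤ (≤-trans (≤-reflexive (wt-split e₂ y)) (deg₂ y)) (≤-trans (≤-reflexive (wt-split e₃ z)) (deg₃ z)))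

  -- The change of the potential under an exchange

  module Exchange (P : Arrangement m) (v x : Fin m)
                  (ωv : Arrangement.ω P v ≡ 1) (ωx : Arrangement.ω P x ≡ 0) where
    open Arrangement P
    open Counting P

    σ : Fin m → Fin m
    σ y = if does (x ≟ᶠ y) then v else y

    ω′ : Fin m → ℕ
    ω′ z = (ω z + δ x z) ∸ δ v z

    -- The truncated subtraction in `ω′` loses nothing: it takes effect only at `v`, where `ω` is 1.
    ω′-def : ∀ z → ω′ z + δ v z ≡ ω z + δ x z
    ω′-def z = m∸n+n≡m δ≤
      where
      δ≤ : δ v z ≤ ω z + δ x z
      δ≤ with v ≟ᶠ z
      ... | yes refl = ≤-trans (≤-reflexive (sym ωv)) (m≤m+n _ _)
      ... | no _     = z≤n

    τx : τ x ≡ 1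
    τx = trans (sym (+-identityʳ _)) (trans (cong (τ x +_) (sym ωx)) (part x))

    private
      σ-δ : ∀ y z → δ (σ y) z + δ x y * δ x z ≡ δ y z + δ x y * δ v z
      σ-δ y z with x ≟ᶠ y
      ... | yes refl = trans (cong (δ v z +_) (+-identityʳ _)) (trans (+-comm (δ v z) _) (cong (δ x z +_) (sym (+-identityʳ _))))
      ... | no _     = refl

      ∑δc : ∀ K → ∑ (downFrom t) (λ i → δ x (c i) * K) ≡ K
      ∑δc K = begin
        ∑ (downFrom t) (λ i → δ x (c i) * K) ≡⟨ ∑-placed (λ y → δ x y * K) ⟩
        ∑ V (λ y → τ y * (δ x y * K))        ≡⟨ ∑-cong V (λ y → swap* (τ y) (δ x y) K) ⟩
        ∑ V (λ y → δ x y * (τ y * K))        ≡⟨ ∑-δ x (λ y → τ y * K) ⟩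
        τ x * K                              ≡⟨ cong (_* K) τx ⟩
        1 * K                                ≡⟨ *-identityˡ K ⟩
        K                                    ∎
        where
        open ≡-Reasoning
        swap* : ∀ a b c → a * (b * c) ≡ b * (a * c)
        swap* = solve-∀

      τ′-def : ∀ z → ∑ (downFrom t) (λ i → δ (σ (c i)) z) + δ x z ≡ τ z + δ v z
      τ′-def z = begin
        ∑ (downFrom t) (λ i → δ (σ (c i)) z) + δ x z
          ≡⟨ cong (∑ (downFrom t) (λ i → δ (σ (c i)) z) +_) (∑δc (δ x z)) ⟨
        ∑ (downFrom t) (λ i → δ (σ (c i)) z) + ∑ (downFrom t) (λ i → δ x (c i) * δ x z)
          ≡⟨ ∑-+ (downFrom t) _ _ ⟨
        ∑ (downFrom t) (λ i → δ (σ (c i)) z + δ x (c i) * δ x z)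
          ≡⟨ ∑-cong (downFrom t) (λ i → σ-δ (c i) z) ⟩
        ∑ (downFrom t) (λ i → δ (c i) z + δ x (c i) * δ v z)
          ≡⟨ ∑-+ (downFrom t) _ _ ⟩
        τ z + ∑ (downFrom t) (λ i → δ x (c i) * δ v z)
          ≡⟨ cong (τ z +_) (∑δc (δ v z)) ⟩
        τ z + δ v z ∎
        where open ≡-Reasoning

    exchange : Arrangement m
    exchange = record
      { t = t ; t≥1 = t≥1 ; c = σ ∘ c ; per = cong σ ∘ per ; ω = ω′
      ; part = λ z → cancel (τ z) (ω z) _ (ω′ z) (δ x z) (δ v z) (τ′-def z) (ω′-def z) (part z) }
      where
      cancel : ∀ a b a′ b′ d e → a′ + d ≡ a + e → b′ + e ≡ b + d → a + b ≡ 1 → a′ + b′ ≡ 1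
      cancel a b a′ b′ d e p q r = +-cancelʳ-≡ (d + e) _ _
        (trans (mid a′ b′ d e) (trans (cong₂ _+_ p q) (trans (mid′ a b d e) (cong (_+ (d + e)) r))))
        where
        mid : ∀ a b d e → a + b + (d + e) ≡ a + d + (b + e)
        mid = solve-∀
        mid′ : ∀ a b d e → a + e + (b + d) ≡ a + b + (d + e)
        mid′ = solve-∀

    -- The unplaced set gains `x` and loses `v`; the additive form avoids subtraction.
    transfer : ∀ (g : Fin m → ℕ) → ∑ V (λ z → ω′ z * g z) + g v ≡ ∑ V (λ z → ω z * g z) + g x
    transfer g = begin
      ∑ V (λ z → ω′ z * g z) + g v                             ≡⟨ cong (∑ V (λ z → ω′ z * g z) +_) (∑-δ v g) ⟨
      ∑ V (λ z → ω′ z * g z) + ∑ V (λ z → δ v z * g z)         ≡⟨ ∑-+ V _ _ ⟨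
      ∑ V (λ z → ω′ z * g z + δ v z * g z)                     ≡⟨ ∑-cong V (λ z → sym (*-distribʳ-+ (g z) (ω′ z) (δ v z))) ⟩
      ∑ V (λ z → (ω′ z + δ v z) * g z)                         ≡⟨ ∑-cong V (λ z → cong (_* g z) (ω′-def z)) ⟩
      ∑ V (λ z → (ω z + δ x z) * g z)                          ≡⟨ ∑-cong V (λ z → *-distribʳ-+ (g z) (ω z) (δ x z)) ⟩
      ∑ V (λ z → ω z * g z + δ x z * g z)                      ≡⟨ ∑-+ V _ _ ⟩
      ∑ V (λ z → ω z * g z) + ∑ V (λ z → δ x z * g z)          ≡⟨ cong (∑ V (λ z → ω z * g z) +_) (∑-δ x g) ⟩
      ∑ V (λ z → ω z * g z) + g x                              ∎
      where open ≡-Reasoning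

    private
      A₂ A₃ A₂′ A₃′ : Fin m → ℕ
      A₂ = wt ω e₂
      A₃ = wt ω e₃
      A₂′ = wt ω′ e₂
      A₃′ = wt ω′ e₃

      ρ-sym : ∀ a b → ρ a b ≡ ρ b a
      ρ-sym a b = cong₂ _+_ (symʳ a b) (cong ((h + h) *_) (cong₂ (λ p q → Δ₃ * p + Δ₂ * q) (sym₂ a b) (sym₃ a b)))

      W W′ : Fin m → ℕ
      W = wt ω ρ
      W′ = wt ω′ ρ

      -- With ω′ = ω + 1ₓ - 1ᵥ, the form with matrix `ρ` changes by 2W(x) - 2W(v) + ρ(x,x) + ρ(v,v)
      -- - 2ρ(v,x). The two diagonal terms are discarded.
      quadratic : ∑ V (λ a → ω a * W a) + (W x + W x) ≤ ∑ V (λ a → ω′ a * W′ a) + (W v + W v) + (ρ v x + ρ v x)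
      quadratic = combine (∑ V (λ a → ω a * W a)) (∑ V (λ a → ω′ a * W′ a)) (∑ V (λ a → ω a * W′ a))
          (W v) (W x) (W′ v) (W′ x) (ρ v v) (ρ v x) (ρ x x) (transfer W′) inner (transfer (ρ v)) (trans (cong (W′ x +_) (ρ-sym v x)) (transfer (ρ x)))
        where
        ∑ρ : ∀ z → ∑ V (λ a → ω a * ρ a z) ≡ W z
        ∑ρ z = ∑-cong V (λ a → cong (ω a *_) (ρ-sym a z))
        inner : ∑ V (λ a → ω a * W′ a) + W v ≡ ∑ V (λ a → ω a * W a) + W x
        inner = begin
          ∑ V (λ a → ω a * W′ a) + W v                              ≡⟨ cong (∑ V (λ a → ω a * W′ a) +_) (∑ρ v) ⟨
          ∑ V (λ a → ω a * W′ a) + ∑ V (λ a → ω a * ρ a v)          ≡⟨ ∑-+ V _ _ ⟨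
          ∑ V (λ a → ω a * W′ a + ω a * ρ a v)                      ≡⟨ ∑-cong V (λ a → sym (*-distribˡ-+ (ω a) (W′ a) (ρ a v))) ⟩
          ∑ V (λ a → ω a * (W′ a + ρ a v))                          ≡⟨ ∑-cong V (λ a → cong (ω a *_) (transfer (ρ a))) ⟩
          ∑ V (λ a → ω a * (W a + ρ a x))                           ≡⟨ ∑-cong V (λ a → *-distribˡ-+ (ω a) (W a) (ρ a x)) ⟩
          ∑ V (λ a → ω a * W a + ω a * ρ a x)                       ≡⟨ ∑-+ V _ _ ⟩
          ∑ V (λ a → ω a * W a) + ∑ V (λ a → ω a * ρ a x)           ≡⟨ cong (∑ V (λ a → ω a * W a) +_) (∑ρ x) ⟩
          ∑ V (λ a → ω a * W a) + W x ∎
          where open ≡-Reasoning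
        combine : ∀ p p′ q wv wx wv′ wx′ rvv rvx rxx → p′ + wv′ ≡ q + wx′ → q + wv ≡ p + wx →
          wv′ + rvv ≡ wv + rvx → wx′ + rvx ≡ wx + rxx → p + (wx + wx) ≤ p′ + (wv + wv) + (rvx + rvx)
        combine p p′ q wv wx wv′ wx′ rvv rvx rxx h₁ h₂ h₃ h₄ = begin
          p + (wx + wx)                     ≤⟨ m≤m+n _ (rvv + rxx) ⟩
          p + (wx + wx) + (rvv + rxx)       ≡⟨ s₁ p wx rvv rxx ⟩
          (p + wx) + (wx + rxx) + rvv       ≡⟨ cong₂ (λ a b → a + b + rvv) h₂ h₄ ⟨
          (q + wv) + (wx′ + rvx) + rvv      ≡⟨ s₂ q wv wx′ rvx rvv ⟩
          (q + wx′) + (wv + rvx + rvv)      ≡⟨ cong (_+ (wv + rvx + rvv)) h₁ ⟨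
          (p′ + wv′) + (wv + rvx + rvv)     ≡⟨ s₃ p′ wv′ wv rvx rvv ⟩
          (wv′ + rvv) + (p′ + wv + rvx)     ≡⟨ cong (_+ (p′ + wv + rvx)) h₃ ⟩
          (wv + rvx) + (p′ + wv + rvx)      ≡⟨ s₄ p′ wv rvx ⟩
          p′ + (wv + wv) + (rvx + rvx)      ∎
          where
          open ≤-Reasoning
          s₁ : ∀ p w r s → p + (w + w) + (r + s) ≡ (p + w) + (w + s) + r
          s₁ = solve-∀
          s₂ : ∀ q w w′ r s → (q + w) + (w′ + r) + s ≡ (q + w′) + (w + r + s)
          s₂ = solve-∀
          s₃ : ∀ p w′ w r s → (p + w′) + (w + r + s) ≡ (w′ + s) + (p + w + r)
          s₃ = solve-∀
          s₄ : ∀ p w r → (w + r) + (p + w + r) ≡ p + (w + w) + (r + r)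
          s₄ = solve-∀

      -- As `x` is placed, it is not among the unplaced neighbours of `z`, so both fit into the
      -- degree of `z`.
      room : ∀ {Δ} e → (∀ a b → e a b ≡ e b a) → (∀ a → ∑ V (e a) ≤ Δ) → ∀ z → wt ω e z + e x z ≤ Δ
      room {Δ} e sym-e deg z = begin
        wt ω e z + e x z          ≡⟨ cong (wt ω e z +_) (sym-e x z) ⟩
        wt ω e z + e z x          ≡⟨ cong (wt ω e z +_) (trans (cong (_* e z x) τx) (*-identityˡ _)) ⟨
        wt ω e z + τ x * e z x    ≤⟨ +-monoʳ-≤ (wt ω e z) (∑-term (λ a → τ a * e z a) (∈-allFin x)) ⟩
        wt ω e z + wt τ e z       ≡⟨ +-comm (wt ω e z) _ ⟩
        wt τ e z + wt ω e z       ≡⟨ wt-split e z ⟩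
        ∑ V (e z)                 ≤⟨ deg z ⟩
        Δ                         ∎
        where open ≤-Reasoning

      -- Contributions of one middle pair (y, z): `before` holds the old product and the links of
      -- `x` to the unplaced set, `links` those of `v`, and `crossed` the chains between `v` and
      -- `x`. `slack` pays for the pairs that contain `x`.
      before links crossed slack : Fin m → Fin m → ℕ
      before y z = A₂ y * A₃ z + (e₂ x y * A₃ z + A₂ y * e₃ x z)
      links y z = e₂ v y * A₃ z + A₂ y * e₃ v z
      crossed y z = e₂ v y * e₃ x z + e₂ x y * e₃ v z
      slack y z = δ x y * (A₂ x * Δ₃) + δ x z * (A₃ x * Δ₂)

      σ-≢ : ∀ {y} → x ≢ y → σ y ≡ y
      σ-≢ {y} x≢y with x ≟ᶠ y
      ... | yes x≡y = ⊥-elim (x≢y x≡y)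
      ... | no _    = refl

      shifted : ∀ e → (∀ a b → e a b ≡ e b a) → ∀ y → wt ω′ e y + e v y ≡ wt ω e y + e x y
      shifted e sym-e y = trans (cong (wt ω′ e y +_) (sym-e v y)) (trans (transfer (e y)) (cong (wt ω e y +_) (sym-e y x)))

      -- Expand (a + p - q)(b + p′ - q′) and discard the nonnegative terms pp′ and qq′.
      unfold : ∀ a a′ b b′ p p′ q q′ → a′ + q ≡ a + p → b′ + q′ ≡ b + p′ →
               a * b + (p * b + a * p′) ≤ a′ * b′ + (q * b + a * q′) + (q * p′ + p * q′)
      unfold a a′ b b′ p p′ q q′ h₁ h₂ = begin
        a * b + (p * b + a * p′)                                ≤⟨ m≤m+n _ (p * p′ + q * q′) ⟩
        a * b + (p * b + a * p′) + (p * p′ + q * q′)            ≡⟨ s₁ a b p p′ (q * q′) ⟩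
        (a + p) * (b + p′) + q * q′                             ≡⟨ cong₂ (λ r s → r * s + q * q′) h₁ h₂ ⟨
        (a′ + q) * (b′ + q′) + q * q′                           ≡⟨ s₂ a′ b′ q q′ ⟩
        a′ * b′ + (q * (b′ + q′) + q′ * (a′ + q))               ≡⟨ cong₂ (λ r s → a′ * b′ + (q * s + q′ * r)) h₁ h₂ ⟩
        a′ * b′ + (q * (b + p′) + q′ * (a + p))                 ≡⟨ s₃ (a′ * b′) a b p p′ q q′ ⟩
        a′ * b′ + (q * b + a * q′) + (q * p′ + p * q′)          ∎
        where
        open ≤-Reasoning
        s₁ : ∀ a b p p′ r → a * b + (p * b + a * p′) + (p * p′ + r) ≡ (a + p) * (b + p′) + r
        s₁ = solve-∀
        s₂ : ∀ a b q q′ → (a + q) * (b + q′) + q * q′ ≡ a * b + (q * (b + q′) + q′ * (a + q))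
        s₂ = solve-∀
        s₃ : ∀ n a b p p′ q q′ → n + (q * (b + p′) + q′ * (a + p)) ≡ n + (q * b + a * q′) + (q * p′ + p * q′)
        s₃ = solve-∀

      -- A middle pair avoiding `x` survives the exchange, and `unfold` applies. If `x` is in the
      -- pair, `v` takes its place and the old contribution is given up; `irr₂` or `irr₃` removes
      -- one term and `room` bounds the rest by `slack`.
      pointwise : ∀ y z → before y z ≤ A₂′ (σ y) * A₃′ (σ z) + links y z + crossed y z + slack y z
      pointwise y z = cases (x ≟ᶠ y) (x ≟ᶠ z)
        where
        open ≤-Reasoning
        regroup : ∀ a b e → a * b + (e * b + a * 0) ≡ b * (a + e)
        regroup = solve-∀
        cases : Dec (x ≡ y) → Dec (x ≡ z) → before y z ≤ A₂′ (σ y) * A₃′ (σ z) + links y z + crossed y z + slack y z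
        cases (yes refl) _ = begin
          A₂ x * A₃ z + (e₂ x x * A₃ z + A₂ x * e₃ x z)     ≡⟨ cong (λ n → A₂ x * A₃ z + (n * A₃ z + A₂ x * e₃ x z)) (irr₂ x) ⟩
          A₂ x * A₃ z + A₂ x * e₃ x z                       ≡⟨ *-distribˡ-+ (A₂ x) _ _ ⟨
          A₂ x * (A₃ z + e₃ x z)                            ≤⟨ *-monoʳ-≤ (A₂ x) (room e₃ sym₃ deg₃ z) ⟩
          A₂ x * Δ₃                                         ≡⟨ *-identityˡ _ ⟨
          1 * (A₂ x * Δ₃)                                   ≡⟨ cong (_* (A₂ x * Δ₃)) (δ-refl x) ⟨
          δ x x * (A₂ x * Δ₃)                               ≤⟨ m≤m+n _ (δ x z * (A₃ x * Δ₂)) ⟩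
          slack x z                                         ≤⟨ m≤n+m (slack x z) (A₂′ (σ x) * A₃′ (σ z) + links x z + crossed x z) ⟩
          A₂′ (σ x) * A₃′ (σ z) + links x z + crossed x z + slack x z ∎
        cases (no _) (yes refl) = begin
          A₂ y * A₃ x + (e₂ x y * A₃ x + A₂ y * e₃ x x)     ≡⟨ cong (λ n → A₂ y * A₃ x + (e₂ x y * A₃ x + A₂ y * n)) (irr₃ x) ⟩
          A₂ y * A₃ x + (e₂ x y * A₃ x + A₂ y * 0)          ≡⟨ regroup (A₂ y) (A₃ x) (e₂ x y) ⟩
          A₃ x * (A₂ y + e₂ x y)                            ≤⟨ *-monoʳ-≤ (A₃ x) (room e₂ sym₂ deg₂ y) ⟩
          A₃ x * Δ₂                                         ≡⟨ *-identityˡ _ ⟨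
          1 * (A₃ x * Δ₂)                                   ≡⟨ cong (_* (A₃ x * Δ₂)) (δ-refl x) ⟨
          δ x x * (A₃ x * Δ₂)                               ≤⟨ m≤n+m _ (δ x y * (A₂ x * Δ₃)) ⟩
          slack y x                                         ≤⟨ m≤n+m (slack y x) (A₂′ (σ y) * A₃′ (σ x) + links y x + crossed y x) ⟩
          A₂′ (σ y) * A₃′ (σ x) + links y x + crossed y x + slack y x ∎
        cases (no x≢y) (no x≢z) = begin
          before y z
            ≤⟨ unfold (A₂ y) (A₂′ y) (A₃ z) (A₃′ z) (e₂ x y) (e₃ x z) (e₂ v y) (e₃ v z) (shifted e₂ sym₂ y) (shifted e₃ sym₃ z) ⟩
          A₂′ y * A₃′ z + links y z + crossed y z
            ≡⟨ cong₂ (λ y′ z′ → A₂′ y′ * A₃′ z′ + links y z + crossed y z) (σ-≢ x≢y) (σ-≢ x≢z) ⟨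
          A₂′ (σ y) * A₃′ (σ z) + links y z + crossed y z
            ≤⟨ m≤m+n _ (slack y z) ⟩
          A₂′ (σ y) * A₃′ (σ z) + links y z + crossed y z + slack y z ∎

      slack-total : near∑ t c slack ≡ (h + h) * (Δ₃ * A₂ x + Δ₂ * A₃ x)
      slack-total = begin
        near∑ t c slack
          ≡⟨ near∑-+ (λ y _ → δ x y * (A₂ x * Δ₃)) (λ _ z → δ x z * (A₃ x * Δ₂)) ⟩
        near∑ t c (λ y _ → δ x y * (A₂ x * Δ₃)) + near∑ t c (λ _ z → δ x z * (A₃ x * Δ₂))
          ≡⟨ cong₂ _+_ (trans (near∑₁ (λ y → δ x y * (A₂ x * Δ₃))) (cong ((h + h) *_) (atx (A₂ x * Δ₃))))
                       (trans (near∑₂ (λ z → δ x z * (A₃ x * Δ₂))) (cong ((h + h) *_) (atx (A₃ x * Δ₂)))) ⟩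
        (h + h) * (A₂ x * Δ₃) + (h + h) * (A₃ x * Δ₂)
          ≡⟨ fin (h + h) (A₂ x) (A₃ x) Δ₂ Δ₃ ⟩
        (h + h) * (Δ₃ * A₂ x + Δ₂ * A₃ x) ∎
        where
        open ≡-Reasoning
        atx : ∀ K → ∑ V (λ y → τ y * (δ x y * K)) ≡ K
        atx K = trans (sym (∑-placed (λ y → δ x y * K))) (∑δc K)
        fin : ∀ n a b p q → n * (a * q) + n * (b * p) ≡ n * (q * a + p * b)
        fin = solve-∀

      C C′ : ℕ
      C  = near∑ t c (λ y z → A₂ y * A₃ z)
      C′ = near∑ t (σ ∘ c) (λ y z → A₂′ y * A₃′ z)

      chains : Fin m → ℕ
      chains a = ∑ V (λ b → ω b * chain t c a b)

      -- This is `pointwise` summed over the near pairs. The total slack is exactly the correction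
      -- that `ρ` contributes to `W x`, so it will cancel against `quadratic`.
      bilinear : C + chains x ≤ C′ + chains v + chain t c v x + (h + h) * (Δ₃ * A₂ x + Δ₂ * A₃ x)
      bilinear = begin
        C + chains x
          ≡⟨ cong (C +_) (chain-wt t c ω x) ⟩
        C + near∑ t c (λ y z → e₂ x y * A₃ z + A₂ y * e₃ x z)
          ≡⟨ near∑-+ (λ y z → A₂ y * A₃ z) (λ y z → e₂ x y * A₃ z + A₂ y * e₃ x z) ⟨
        near∑ t c before
          ≤⟨ near∑-mono pointwise ⟩
        near∑ t c (λ y z → after y z + links y z + crossed y z + slack y z)
          ≡⟨ near∑-+ (λ y z → after y z + links y z + crossed y z) slack ⟩
        near∑ t c (λ y z → after y z + links y z + crossed y z) + near∑ t c slack
          ≡⟨ cong₂ _+_ (near∑-+ (λ y z → after y z + links y z) crossed) slack-total ⟩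
        near∑ t c (λ y z → after y z + links y z) + chain t c v x + S
          ≡⟨ cong (λ n → n + chain t c v x + S) (near∑-+ after links) ⟩
        C′ + near∑ t c links + chain t c v x + S
          ≡⟨ cong (λ n → C′ + n + chain t c v x + S) (chain-wt t c ω v) ⟨
        C′ + chains v + chain t c v x + S ∎
        where
        open ≤-Reasoning
        S = (h + h) * (Δ₃ * A₂ x + Δ₂ * A₃ x)
        after : Fin m → Fin m → ℕ
        after y z = A₂′ (σ y) * A₃′ (σ z)

      l-split : ∀ a → l a ≡ chains a + wt ω rd a
      l-split a = trans (∑-cong V (λ b → *-distribˡ-+ (ω b) _ _)) (∑-+ V _ _)

      W-split : ∀ a → W a ≡ wt ω rd a + (h + h) * (Δ₃ * A₂ a + Δ₂ * A₃ a)
      W-split a = begin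
        W a
          ≡⟨ ∑-cong V (λ b → distrib (ω b) (rd a b) (h + h) Δ₃ (e₂ a b) Δ₂ (e₃ a b)) ⟩
        ∑ V (λ b → ω b * rd a b + (h + h) * (Δ₃ * (ω b * e₂ a b) + Δ₂ * (ω b * e₃ a b)))
          ≡⟨ ∑-+ V _ _ ⟩
        wt ω rd a + ∑ V (λ b → (h + h) * (Δ₃ * (ω b * e₂ a b) + Δ₂ * (ω b * e₃ a b)))
          ≡⟨ cong (wt ω rd a +_) (trans (∑-*ˡ V (h + h) _) (cong ((h + h) *_)
               (trans (∑-+ V _ _) (cong₂ _+_ (∑-*ˡ V Δ₃ _) (∑-*ˡ V Δ₂ _))))) ⟩
        wt ω rd a + (h + h) * (Δ₃ * A₂ a + Δ₂ * A₃ a) ∎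
        where
        open ≡-Reasoning
        distrib : ∀ w r n p a q b → w * (r + n * (p * a + q * b)) ≡ w * r + n * (p * (w * a) + q * (w * b))
        distrib = solve-∀

    -- Twice `bilinear` plus `quadratic` compares the two potentials. The slack at `x` cancels, and
    -- what remains is twice the claim.
    exchange-links : Δ₃ * e₂ v x + Δ₂ * e₃ v x ≡ 0 → Φ t (σ ∘ c) ω′ ≤ Φ t c ω →
                     l x ≤ l v + (h + h) * (Δ₃ * wt ω e₂ v + Δ₂ * wt ω e₃ v) + μ t c v x
    exchange-links nonadj Φ′≤Φ = *-cancelˡ-≤ 2 (+-cancelʳ-≤ (2 * C + Pω + 2 * Sx) _ _ (begin
      2 * l x + (2 * C + Pω + 2 * Sx)
        ≡⟨ cong (λ n → 2 * n + (2 * C + Pω + 2 * Sx)) (l-split x) ⟩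
      2 * (chains x + rx) + (2 * C + Pω + 2 * Sx)
        ≡⟨ s₁ (chains x) rx C Pω Sx ⟩
      2 * (C + chains x) + (Pω + ((rx + Sx) + (rx + Sx)))
        ≡⟨ cong (λ n → 2 * (C + chains x) + (Pω + (n + n))) (W-split x) ⟨
      2 * (C + chains x) + (Pω + (W x + W x))
        ≤⟨ +-mono-≤ (*-monoʳ-≤ 2 bilinear) quadratic ⟩
      2 * (C′ + chains v + chain t c v x + Sx) + (Pω′ + (W v + W v) + (ρ v x + ρ v x))
        -- By `nonadj` the correction in `ρ v x` vanishes, which leaves `rd v x`.
        ≡⟨ cong₂ (λ n o → 2 * (C′ + chains v + chain t c v x + Sx) + (Pω′ + (n + n) + (o + o))) (W-split v)
             (trans (cong (λ n → rd v x + (h + h) * n) nonadj) (trans (cong (rd v x +_) (*-zeroʳ (h + h))) (+-identityʳ _))) ⟩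
      2 * (C′ + chains v + chain t c v x + Sx) + (Pω′ + ((rv + Sv) + (rv + Sv)) + (rd v x + rd v x))
        ≡⟨ s₂ C′ (chains v) (chain t c v x) Sx Pω′ rv Sv (rd v x) ⟩
      2 * (chains v + rv + Sv + (chain t c v x + rd v x)) + (2 * C′ + Pω′ + 2 * Sx)
        ≤⟨ +-monoʳ-≤ (2 * (chains v + rv + Sv + μ t c v x)) (+-monoˡ-≤ (2 * Sx) Φ′≤Φ) ⟩
      2 * (chains v + rv + Sv + μ t c v x) + (2 * C + Pω + 2 * Sx)
        ≡⟨ cong (λ n → 2 * (n + Sv + μ t c v x) + (2 * C + Pω + 2 * Sx)) (l-split v) ⟨
      2 * (l v + Sv + μ t c v x) + (2 * C + Pω + 2 * Sx) ∎))
      where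
      open ≤-Reasoning
      Sx = (h + h) * (Δ₃ * A₂ x + Δ₂ * A₃ x)
      Sv = (h + h) * (Δ₃ * A₂ v + Δ₂ * A₃ v)
      rx = wt ω rd x
      rv = wt ω rd v
      Pω = ∑ V (λ a → ω a * W a)
      Pω′ = ∑ V (λ a → ω′ a * W′ a)
      s₁ : ∀ l r c p s → 2 * (l + r) + (2 * c + p + 2 * s) ≡ 2 * (c + l) + (p + ((r + s) + (r + s)))
      s₁ = solve-∀
      s₂ : ∀ c l m s p r q d → 2 * (c + l + m + s) + (p + ((r + q) + (r + q)) + (d + d)) ≡
           2 * (l + r + q + (m + d)) + (2 * c + p + 2 * s)
      s₂ = solve-∀

    -- The surplus `Sv` from `exchange-links` is precisely what `links-bound` allows on top of
    -- `k v + l v`.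
    exchange-bound : Δ₃ * e₂ v x + Δ₂ * e₃ v x ≡ 0 → Φ t (σ ∘ c) ω′ ≤ Φ t c ω →
                     l x + k v ≤ 4 * h * (Δ₂ * Δ₃) + R + μ t c v x
    exchange-bound nonadj Φ′≤Φ = begin
      l x + k v                                             ≤⟨ +-monoˡ-≤ (k v) (exchange-links nonadj Φ′≤Φ) ⟩
      l v + Sv + μ t c v x + k v                            ≡⟨ regroup (l v) Sv (μ t c v x) (k v) ⟩
      (k v + l v + Sv) + μ t c v x                          ≤⟨ +-monoˡ-≤ (μ t c v x) (links-bound v) ⟩
      4 * h * (Δ₂ * Δ₃) + R + μ t c v x                     ∎
      where
      open ≤-Reasoning
      Sv = (h + h) * (Δ₃ * A₂ v + Δ₂ * A₃ v)
      regroup : ∀ a b c d → a + b + c + d ≡ (d + a + b) + c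
      regroup = solve-∀

  -- Conflict-freeness under insertion and exchange

  -- Because of r < t a short cycle does not wrap onto itself, and an insertion creates no nearness
  -- between old vertices.
  Near→ Near : ℕ → (ℕ → Fin m) → Fin m → Fin m → Set
  Near→ t c x y = ∃₂ λ i r → 1 ≤ r × r ≤ h × r < t × c i ≡ x × c (i + r) ≡ y
  Near t c x y = Near→ t c x y ⊎ Near→ t c y x

  -- The four inequalities in `quad` say that the edges xy and x′y′ are vertex-disjoint. In a bag,
  -- x, x′ come from one clique and y, y′ from the other.
  record ConflictFree (t : ℕ) (c : ℕ → Fin m) : Set where
    field
      pair : ∀ {x y} → Near t c x y → x ≢ y → rd x y ≡ 0
      quad : ∀ {x x′ y y′} → Near t c x x′ → Near t c y y′ → x ≢ x′ → y ≢ y′ → x ≢ y′ → x′ ≢ y →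
             1 ≤ e₂ x y → 1 ≤ e₃ x′ y′ → ⊥

  module Periodic (P : Arrangement m) where
    open Arrangement P
    open Counting P

    private instance
      t≢0 : NonZero t
      t≢0 = >-nonZero t≥1

    per* : ∀ i k → c (i + k * t) ≡ c i
    per* i zero    = cong c (+-identityʳ i)
    per* i (suc k) = trans (cong c (trans (cong (i +_) (+-comm t (k * t))) (sym (+-assoc i _ t)))) (trans (per _) (per* i k))

    c-% : ∀ i s → c (i % t + s) ≡ c (i + s)
    c-% i s = trans (sym (per* (i % t + s) (i / t))) (cong c (trans (lem (i % t) s (i / t * t)) (cong (_+ s) (sym (m≡m%n+[m/n]*n i t)))))
      where
      lem : ∀ a b d → a + b + d ≡ a + d + b
      lem = solve-∀

    c-%₀ : ∀ i → c (i % t) ≡ c i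
    c-%₀ i = trans (cong c (sym (+-identityʳ _))) (trans (c-% i 0) (cong c (+-identityʳ i)))

    τ≤1 : ∀ v → τ v ≤ 1
    τ≤1 v = ≤-trans (m≤m+n _ (ω v)) (≤-reflexive (part v))

    injective : ∀ {i j} → i < t → j < t → c i ≡ c j → i ≡ j
    injective {i} {j} i<t j<t ci≡cj with i ≟ j
    ... | yes i≡j = i≡j
    ... | no i≢j  = ⊥-elim (<⇒≱ {1} {2} ≤-refl (≤-trans (≤-reflexive (sym (cong₂ _+_ (δ-refl (c i)) (trans (cong (δ (c j)) ci≡cj) (δ-refl (c j))))))
                     (≤-trans (∑-two-terms (λ z → δ (c z) (c i)) (∈-downFrom⁺ i<t) (∈-downFrom⁺ j<t) i≢j) (τ≤1 (c i)))))

    -- A vertex occurs once per period, so equal entries stand at congruent positions and have the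
    -- same surroundings.
    c-shift : ∀ {a b} → c a ≡ c b → ∀ s → c (a + s) ≡ c (b + s)
    c-shift {a} {b} eq s = trans (sym (c-% a s)) (trans (cong (λ z → c (z + s)) a%≡b%) (c-% b s))
      where
      a%≡b% : a % t ≡ b % t
      a%≡b% = injective (m%n<n a t) (m%n<n b t) (trans (c-%₀ a) (trans eq (sym (c-%₀ b))))

    unplaced⇒≢ : ∀ {v} → ω v ≡ 1 → ∀ i → c i ≢ v
    unplaced⇒≢ {v} ωv i refl = 1+n≢0 (trans (sym (δ-refl (c i))) (trans (cong (λ z → δ z (c i)) (sym (c-%₀ i)))
      (∑≡0⇒ (λ z → δ (c z) (c i)) τ≡0 (∈-downFrom⁺ (m%n<n i t)))))
      where
      τ≡0 : τ (c i) ≡ 0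
      τ≡0 = +-cancelʳ-≡ 1 _ _ (trans (cong (τ (c i) +_) (sym ωv)) (part (c i)))

    -- Reducing the first index modulo `t` turns any near pair into a listed one; thus a chain
    -- through it makes `μ` positive.
    near∑-term : ∀ f {y z} → Near t c y z → f y z ≤ near∑ t c f
    near∑-term f {y} {z} near = subst (f y z ≤_) (sym (near∑-def t c f)) (go near)
      where
      term : ℕ → ℕ → ℕ
      term i r = f (c i) (c (i + suc r)) + f (c (i + suc r)) (c i)
      bound : ∀ i r → suc r ≤ h → term i r ≤ ∑ (downFrom t) (λ i → ∑ (downFrom h) (term i))
      bound i r r<h = subst (_≤ ∑ (downFrom t) (λ i → ∑ (downFrom h) (term i))) (cong₂ (λ a b → f a b + f b a) (c-%₀ i) (c-% i (suc r)))
        (≤-trans (∑-term (term (i % t)) (∈-downFrom⁺ r<h))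
                 (∑-term (λ i → ∑ (downFrom h) (term i)) (∈-downFrom⁺ (m%n<n i t))))
      go : Near t c y z → f y z ≤ ∑ (downFrom t) (λ i → ∑ (downFrom h) (term i))
      go (inj₁ (i , suc r , _ , r≤h , _ , refl , refl)) = ≤-trans (m≤m+n _ _) (bound i r r≤h)
      go (inj₂ (i , suc r , _ , r≤h , _ , refl , refl)) = ≤-trans (m≤n+m _ _) (bound i r r≤h)

    -- The near pairs that may appear once `v` has been placed: old ones, and pairs of `v` with a
    -- vertex not linked to it. The case `both` is harmless as conflicts concern pairs of distinct
    -- vertices.
    data Extended (v x y : Fin m) : Set where
      old   : Near t c x y → Extended v x y
      left  : x ≡ v → μ t c v y ≡ 0 → Extended v x y
      right : y ≡ v → μ t c v x ≡ 0 → Extended v x y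
      both  : x ≡ v → y ≡ v → Extended v x y

    Extended-sym : ∀ {v x y} → Extended v x y → Extended v y x
    Extended-sym (old (inj₁ n)) = old (inj₂ n)
    Extended-sym (old (inj₂ n)) = old (inj₁ n)
    Extended-sym (left p q)     = right p q
    Extended-sym (right p q)    = left p q
    Extended-sym (both p q)     = both q p

    -- A conflict at a new pair of `v` and a would show up in `μ`: non-adjacency in the part `rd`,
    -- and a conflict with an old pair as a chain between `v` and a.
    extend : ∀ {t′ c′ v} → (∀ {x y} → Near→ t′ c′ x y → Extended v x y) → ConflictFree t c → ConflictFree t′ c′
    extend {t′} {c′} {v} ext good = record
      { pair = λ n x≢y → pair′ (ext′ n) x≢y
      ; quad = λ n n′ a b d e → quad′ (ext′ n) (ext′ n′) a b d e }
      where
      open ConflictFree good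
      ext′ : ∀ {x y} → Near t′ c′ x y → Extended v x y
      ext′ (inj₁ n) = ext n
      ext′ (inj₂ n) = Extended-sym (ext n)
      pair′ : ∀ {x y} → Extended v x y → x ≢ y → rd x y ≡ 0
      pair′ (old n)           x≢y = pair n x≢y
      pair′ (left refl μ≡0)   x≢y = m+n≡0⇒n≡0 (chain t c v _) μ≡0
      pair′ (right refl μ≡0)  x≢y = trans (symʳ _ v) (m+n≡0⇒n≡0 (chain t c v _) μ≡0)
      pair′ (both refl refl)  x≢y = ⊥-elim (x≢y refl)
      absurd : ∀ {a y z} → μ t c v a ≡ 0 → Near t c y z → 1 ≤ e₂ v y → 1 ≤ e₃ a z → ⊥
      absurd {a} {y} {z} μ≡0 n p q = <⇒≱ (≤-trans (*-mono-≤ p q)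
        (≤-trans (m≤m+n _ _) (≤-trans (near∑-term (λ y z → e₂ v y * e₃ a z + e₂ a y * e₃ v z) n) (m≤m+n _ (rd v a))))) (≤-reflexive μ≡0)
      absurd′ : ∀ {a y z} → μ t c v a ≡ 0 → Near t c y z → 1 ≤ e₂ a y → 1 ≤ e₃ v z → ⊥
      absurd′ {a} {y} {z} μ≡0 n p q = <⇒≱ (≤-trans (*-mono-≤ p q)
        (≤-trans (m≤n+m _ (e₂ v y * e₃ a z)) (≤-trans (near∑-term (λ y z → e₂ v y * e₃ a z + e₂ a y * e₃ v z) n) (m≤m+n _ (rd v a))))) (≤-reflexive μ≡0)
      flip₂ : ∀ {a b} → 1 ≤ e₂ a b → 1 ≤ e₂ b a
      flip₂ = subst (1 ≤_) (sym₂ _ _)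
      flip₃ : ∀ {a b} → 1 ≤ e₃ a b → 1 ≤ e₃ b a
      flip₃ = subst (1 ≤_) (sym₃ _ _)
      loop₂ : ∀ {a} → 1 ≤ e₂ a a → ⊥
      loop₂ {a} p = <⇒≱ p (≤-reflexive (irr₂ a))
      loop₃ : ∀ {a} → 1 ≤ e₃ a a → ⊥
      loop₃ {a} p = <⇒≱ p (≤-reflexive (irr₃ a))
      quad′ : ∀ {x x′ y y′} → Extended v x x′ → Extended v y y′ → x ≢ x′ → y ≢ y′ → x ≢ y′ → x′ ≢ y →
              1 ≤ e₂ x y → 1 ≤ e₃ x′ y′ → ⊥
      quad′ (old n)          (old n′)         a b d e p q = quad n n′ a b d e p q
      quad′ (left refl μ≡0)  (old n)          a b d e p q = absurd μ≡0 n p q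
      quad′ (right refl μ≡0) (old n)          a b d e p q = absurd′ μ≡0 n p q
      quad′ (old n)          (left refl μ≡0)  a b d e p q = absurd μ≡0 n (flip₂ p) (flip₃ q)
      quad′ (old n)          (right refl μ≡0) a b d e p q = absurd′ μ≡0 n (flip₂ p) (flip₃ q)
      quad′ (both refl refl) _                a b d e p q = a refl
      quad′ _                (both refl refl) a b d e p q = b refl
      -- Both pairs contain `v`: one of the two edges would be a loop, or the edges would share `v`.
      quad′ (left refl _)    (left refl _)    a b d e p q = loop₂ p
      quad′ (left refl _)    (right refl _)   a b d e p q = d refl
      quad′ (right refl _)   (left refl _)    a b d e p q = e refl
      quad′ (right refl _)   (right refl _)   a b d e p q = loop₃ q

    -- The vertex v is put between c (j + h - 1) and c (j + h).
    module Insert (v : Fin m) (ωv : ω v ≡ 1) (j : ℕ) where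

      -- The old cycle is read once round from `j + h` on, and `v` closes it at position `t`. So the
      -- vertices that come within distance `h` of `v` are those of the window of length 2h from `j`
      -- on.
      slot : ℕ → Fin m
      slot i with i <? t
      ... | yes _ = c (i + (j + h))
      ... | no _  = v

      slot-< : ∀ {i} → i < t → slot i ≡ c (i + (j + h))
      slot-< {i} i<t with i <? t
      ... | yes _  = refl
      ... | no i≮t = ⊥-elim (i≮t i<t)

      slot-t : slot t ≡ v
      slot-t with t <? t
      ... | yes t<t = ⊥-elim (<-irrefl refl t<t)
      ... | no _    = refl

      insert : Arrangement m
      insert = record
        { t = suc t ; t≥1 = s≤s z≤n ; c = λ i → slot (i % suc t)
        ; per = λ i → cong slot ([m+n]%n≡m%n i (suc t))
        ; ω = λ z → ω z ∸ δ v z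
        ; part = part′ }
        where
        old-sum : ∀ z → ∑ (downFrom t) (λ i → δ (slot (i % suc t)) z) ≡ τ z
        old-sum z = trans (∑-cong-∈ (downFrom t) (λ {i} i∈ → cong (λ y → δ y z)
            (trans (cong slot (m<n⇒m%n≡m (m<n⇒m<1+n (∈-downFrom⁻ i∈)))) (slot-< (∈-downFrom⁻ i∈)))))
          (∑-shift t (λ i → δ (c i) z) (λ i → cong (λ y → δ y z) (per i)) (j + h))
        part′ : ∀ z → ∑ (downFrom (suc t)) (λ i → δ (slot (i % suc t)) z) + (ω z ∸ δ v z) ≡ 1
        part′ z rewrite old-sum z | m<n⇒m%n≡m (n<1+n t) | slot-t with v ≟ᶠ z
        ... | yes refl = cong₂ _+_ (cong suc (+-cancelʳ-≡ 1 _ _ (trans (cong (τ v +_) (sym ωv)) (part v)))) (cong (_∸ 1) ωv)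
        ... | no _     = part z

      insert-good : (∀ {r} → r < h + h → μ t c v (c (j + r)) ≡ 0) →
                    ConflictFree t c → ConflictFree (suc t) (Arrangement.c insert)
      insert-good clear = extend ext
        where
        free : ∀ {i r} → r < h + h → c i ≡ c (j + r) → μ t c v (c i) ≡ 0
        free r< eq = trans (cong (μ t c v) eq) (clear r<)
        reindex : ∀ a r j h → a + r + (j + h) ≡ a + (j + h) + r
        reindex = solve-∀
        cases : ∀ i r → 1 ≤ r → r ≤ h → r < suc t → i < suc t → Extended v (slot i) (slot ((i + r) % suc t))
        cases i r 1≤r r≤h r≤t i≤t with <-cmp i t
        -- `v` stands at `t`; the vertex `suc r` places further is in slot `r`, which is entry
        -- `h + r` of the window.
        cases i (suc r) 1≤r r≤h (s≤s r<t) i≤t | tri≈ _ refl _ = left slot-t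
          (trans (cong (λ z → μ t c v (slot z)) wrap) (trans (cong (μ t c v) (slot-< r<t))
            (free {r = h + r} (+-monoʳ-< h r≤h) (cong c (lem r j h)))))
          where
          wrap : (t + suc r) % suc t ≡ r
          wrap = trans (cong (_% suc t) (trans (+-suc t r) (+-comm (suc t) r))) (trans ([m+n]%n≡m%n r (suc t)) (m<n⇒m%n≡m (m<n⇒m<1+n r<t)))
          lem : ∀ r j h → r + (j + h) ≡ j + (h + r)
          lem = solve-∀
        cases i r 1≤r r≤h r≤t i≤t | tri> _ _ t<i = ⊥-elim (<⇒≱ t<i (≤-pred i≤t))
        cases i r 1≤r r≤h r≤t i≤t | tri< i<t _ _ with <-cmp (i + r) t
        ... | tri< i+r<t _ _ = old (inj₁ (i + (j + h) , r , 1≤r , r≤h , ≤-trans (s≤s (m≤n+m r i)) i+r<t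
                , sym (slot-< i<t)
                , sym (trans (cong slot (m<n⇒m%n≡m (m<n⇒m<1+n i+r<t))) (trans (slot-< i+r<t) (cong c (reindex i r j h))))))
        -- The first vertex stands `r` places before `v`, hence at entry `h ∸ r` of the window.
        ... | tri≈ _ i+r≡t _ = right (trans (cong slot (trans (cong (_% suc t) i+r≡t) (m<n⇒m%n≡m (n<1+n t)))) slot-t)
                (trans (cong (μ t c v) (slot-< i<t)) (free {r = h ∸ r} (≤-<-trans (m∸n≤m h r) (m<m+n h (≤-trans 1≤r r≤h)))
                  (trans (cong c position) (per _))))
          where
          open ≡-Reasoning
          lem₁ : ∀ i j d r → i + (j + (d + r)) ≡ j + d + (i + r)
          lem₁ = solve-∀
          position : i + (j + h) ≡ j + (h ∸ r) + t
          position = begin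
            i + (j + h)                ≡⟨ cong (λ z → i + (j + z)) (m∸n+n≡m r≤h) ⟨
            i + (j + (h ∸ r + r))      ≡⟨ lem₁ i j (h ∸ r) r ⟩
            j + (h ∸ r) + (i + r)      ≡⟨ cong (j + (h ∸ r) +_) i+r≡t ⟩
            j + (h ∸ r) + t            ∎
        -- The pair straddles `v`, so its old offset is one less. It stays positive as i < t < i +
        -- suc r, and `suc r < suc t` turns into the required `r < t`.
        cases i (suc r) 1≤r r≤h (s≤s r<t) i≤t | tri< i<t _ _ | tri> _ _ t<i+r =
          old (inj₁ (i + (j + h) , r , r≥1 , <⇒≤ r≤h , r<t , sym (slot-< i<t) , sym second))
          where
          z : ℕ
          z = i + suc r ∸ suc t
          z+ : z + suc t ≡ i + suc r
          z+ = m∸n+n≡m t<i+r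
          r≥1 : 1 ≤ r
          r≥1 = +-cancelˡ-< i _ _ (subst (_< i + r) (sym (+-identityʳ i)) (<-≤-trans i<t (≤-pred (subst (t <_) (+-suc i r) t<i+r))))
          z<t : z < t
          z<t = +-cancelʳ-< (suc t) _ _ (subst (_< t + suc t) (sym z+) (+-mono-< i<t (s≤s r<t)))
          z+t : z + t ≡ i + r
          z+t = suc-injective (trans (sym (+-suc z t)) (trans z+ (+-suc i r)))
          second : slot ((i + suc r) % suc t) ≡ c (i + (j + h) + r)
          second = begin
            slot ((i + suc r) % suc t)  ≡⟨ cong (λ n → slot (n % suc t)) z+ ⟨
            slot ((z + suc t) % suc t)  ≡⟨ cong slot ([m+n]%n≡m%n z (suc t)) ⟩
            slot (z % suc t)            ≡⟨ cong slot (m<n⇒m%n≡m (m<n⇒m<1+n z<t)) ⟩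
            slot z                      ≡⟨ slot-< z<t ⟩
            c (z + (j + h))             ≡⟨ per _ ⟨
            c (z + (j + h) + t)         ≡⟨ cong c (reindex z t j h) ⟨
            c (z + t + (j + h))         ≡⟨ cong (λ n → c (n + (j + h))) z+t ⟩
            c (i + r + (j + h))         ≡⟨ cong c (reindex i r j h) ⟩
            c (i + (j + h) + r)         ∎
            where open ≡-Reasoning
        ext : ∀ {x y} → Near→ (suc t) (Arrangement.c insert) x y → Extended v x y
        ext (i , r , 1≤r , r≤h , r<t , refl , refl) =
          subst (Extended v (slot (i % suc t))) (cong slot mod) (cases (i % suc t) r 1≤r r≤h r<t (m%n<n i (suc t)))
          where
          mod : (i % suc t + r) % suc t ≡ (i + r) % suc t
          mod = trans (cong (λ n → (i % suc t + n) % suc t) (sym (m<n⇒m%n≡m r<t))) (sym (%-distribˡ-+ i r (suc t)))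

    -- `v` inherits the surroundings of `x`, and by the two clearness hypotheses these hold no
    -- vertex linked to `v`.
    exchange-good : ∀ {v x} (ωv : ω v ≡ 1) (ωx : ω x ≡ 0) i₀ → c (i₀ + h) ≡ x →
                    (∀ {s} → s < h → μ t c v (c (i₀ + h + suc s)) ≡ 0) → (∀ {s} → s < h → μ t c v (c (i₀ + s)) ≡ 0) →
                    ConflictFree t c → ConflictFree t (Exchange.σ P v x ωv ωx ∘ c)
    exchange-good {v} {x} ωv ωx i₀ refl clearʳ clearˡ = extend ext
      where
      open Exchange P v x ωv ωx using (σ)
      ext : ∀ {y z} → Near→ t (σ ∘ c) y z → Extended v y z
      ext (i , suc r , 1≤r , r<h , r<t , refl , refl) with x ≟ᶠ c i | x ≟ᶠ c (i + suc r)
      ... | yes p | yes q = both refl refl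
      ... | yes p | no ¬q = left refl (trans (cong (μ t c v) (sym (c-shift p (suc r)))) (clearʳ r<h))
      ... | no ¬p | yes q = right refl (trans (cong (μ t c v) back) (clearˡ {h ∸ suc r} (∸-monoʳ-< {h} (s≤s z≤n) r<h)))
        where
        open ≡-Reasoning
        -- `c-shift` only moves forward, so going back `suc r` places is replaced by completing the
        -- period.
        s = t ∸ suc r
        s+ : suc r + s ≡ t
        s+ = m+[n∸m]≡n (<⇒≤ r<t)
        lem : ∀ i d r s → i + (d + r) + s ≡ i + d + (r + s)
        lem = solve-∀
        back : c i ≡ c (i₀ + (h ∸ suc r))
        back = begin
          c i                                         ≡⟨ per i ⟨
          c (i + t)                                   ≡⟨ cong (λ n → c (i + n)) s+ ⟨
          c (i + (suc r + s))                         ≡⟨ cong c (+-assoc i (suc r) s) ⟨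
          c (i + suc r + s)                           ≡⟨ c-shift q s ⟨
          c (i₀ + h + s)                              ≡⟨ cong (λ n → c (i₀ + n + s)) (m∸n+n≡m r<h) ⟨
          c (i₀ + (h ∸ suc r + suc r) + s)            ≡⟨ cong c (lem i₀ (h ∸ suc r) (suc r) s) ⟩
          c (i₀ + (h ∸ suc r) + (suc r + s))          ≡⟨ cong (λ n → c (i₀ + (h ∸ suc r) + n)) s+ ⟩
          c (i₀ + (h ∸ suc r) + t)                    ≡⟨ per _ ⟩
          c (i₀ + (h ∸ suc r))                        ∎
      ... | no ¬p | no ¬q = old (inj₁ (i , suc r , 1≤r , r<h , r<t , refl , refl))

  -- The count when no move is possible

  Λ : ℕ
  Λ = 4 * h * (Δ₂ * Δ₃) + R + 1

  -- The lower bound on m that the hypotheses of the theorem give for h = ℓ - 1 and R = m - δ₁; see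
  -- `minDegree-large`.
  threshold : ℕ
  threshold = 4 * h + 2 + 5 * (h + 1) * (2 * h + 1) * (Δ₂ * Δ₃) + (2 * h + 1) * (2 * h + 1) * R

  module Stuck (P : Arrangement m) where
    open Arrangement P
    open Counting P
    open Periodic P using (τ≤1)

    X : Fin m → ℕ → ℕ
    X v i = 1 ⊓ μ t c v (c i)

    -- These unfold to the functions of `Spacing` for the sequence `X v`, but are available without
    -- its hypothesis `hit`.
    clearʳ clearˡ : Fin m → ℕ → ℕ
    clearʳ v i = 1 ∸ ∑ (downFrom h) (λ s → X v (i + suc s))
    clearˡ v i = 1 ∸ ∑ (downFrom h) (λ s → X v (i + s))

    X≤1 : ∀ v i → X v i ≤ 1
    X≤1 v i = m⊓n≤m 1 (μ t c v (c i))

    X≤μ : ∀ v i → X v i ≤ μ t c v (c i)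
    X≤μ v i = m⊓n≤n 1 (μ t c v (c i))

    clear≤1 : ∀ v i → clearʳ v (i + h) * clearˡ v i ≤ 1
    clear≤1 v i = *-mono-≤ (m∸n≤m 1 (∑ (downFrom h) (λ s → X v (i + h + suc s))))
                           (m∸n≤m 1 (∑ (downFrom h) (λ s → X v (i + s))))

    -- Its vanishing is the condition in `exchange-bound`. With these weights the sum over all `x`
    -- is at most 2Δ₂Δ₃.
    adjacent : Fin m → Fin m → ℕ
    adjacent v x = Δ₃ * e₂ v x + Δ₂ * e₃ v x

    -- The indicator of the positions i for which v can be exchanged for c (i + h).
    good : Fin m → ℕ → ℕ
    good v i = X v (i + h) * (clearʳ v (i + h) * clearˡ v i) * (1 ∸ adjacent v (c (i + h)))

    good≤X : ∀ v i → good v i ≤ X v (i + h)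
    good≤X v i = begin
      X v (i + h) * (clearʳ v (i + h) * clearˡ v i) * (1 ∸ adjacent v (c (i + h)))
        ≤⟨ *-mono-≤ (*-monoʳ-≤ (X v (i + h)) (clear≤1 v i)) (m∸n≤m 1 (adjacent v (c (i + h)))) ⟩
      X v (i + h) * 1 * 1
        ≡⟨ trans (*-identityʳ (X v (i + h) * 1)) (*-identityʳ (X v (i + h))) ⟩
      X v (i + h) ∎
      where open ≤-Reasoning

    good≤1 : ∀ v i → good v i ≤ 1
    good≤1 v i = ≤-trans (good≤X v i) (X≤1 v (i + h))

    good≤μ : ∀ v i → good v i ≤ μ t c v (c (i + h))
    good≤μ v i = ≤-trans (good≤X v i) (X≤μ v (i + h))

    ω≤1 : ∀ v → ω v ≤ 1
    ω≤1 v = ≤-trans (m≤n+m (ω v) (τ v)) (≤-reflexive (part v))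

    ω-cases : ∀ v → ω v ≡ 0 ⊎ ω v ≡ 1
    ω-cases v with ω v | ω≤1 v
    ... | 0 | _       = inj₁ refl
    ... | 1 | _       = inj₂ refl
    ... | suc (suc _) | s≤s ()

    u : ℕ
    u = ∑ V ω

    ∑ω-mono : ∀ {f g : Fin m → ℕ} → (∀ v → ω v ≡ 1 → f v ≤ g v) → ∑ V (λ v → ω v * f v) ≤ ∑ V (λ v → ω v * g v)
    ∑ω-mono {f} {g} le = ∑-mono V pointwise
      where
      pointwise : ∀ v → ω v * f v ≤ ω v * g v
      pointwise v with ω-cases v
      ... | inj₁ ω≡0 rewrite ω≡0 = z≤n
      ... | inj₂ ω≡1 rewrite ω≡1 = *-monoʳ-≤ 1 (le v ω≡1)

    γ : Fin m → ℕ
    γ v = ∑ (downFrom t) (good v)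

    module _ (blocked : ∀ v → ω v ≡ 1 → ∀ {j} → j < t → ∃ λ r → r < h + h × 1 ≤ μ t c v (c (j + r))) where

      -- Each of the `t` windows of length 2h contains a link of `v`, and each link is seen by 2h
      -- windows.
      t≤2hk : ∀ v → ω v ≡ 1 → t ≤ (h + h) * k v
      t≤2hk v ωv = begin
        t                                   ≡⟨ length-downFrom t ⟨
        length (downFrom t)                 ≡⟨ *-identityʳ _ ⟨
        length (downFrom t) * 1             ≡⟨ ∑-const (downFrom t) 1 ⟨
        ∑ (downFrom t) (λ _ → 1)            ≤⟨ ∑-mono-∈ (downFrom t) window ⟩
        ∑ (downFrom t) (λ j → ∑ (downFrom (h + h)) (λ r → μ t c v (c (j + (r + 0)))))
                                            ≡⟨ ∑-double-shift t (h + h) (λ i → μ t c v (c i)) (cong (μ t c v) ∘ per) 0 ⟩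
        (h + h) * ∑ (downFrom t) (λ i → μ t c v (c i))
                                            ≡⟨ cong ((h + h) *_) (∑-placed (μ t c v)) ⟩
        (h + h) * k v                       ∎
        where
        open ≤-Reasoning
        window : ∀ {j} → j ∈ downFrom t → 1 ≤ ∑ (downFrom (h + h)) (λ r → μ t c v (c (j + (r + 0))))
        window {j} j∈ with blocked v ωv (∈-downFrom⁻ j∈)
        ... | r , r< , 1≤μ = ≤-trans (subst (λ n → 1 ≤ μ t c v (c (j + n))) (sym (+-identityʳ r)) 1≤μ)
                               (∑-term (λ r → μ t c v (c (j + (r + 0)))) (∈-downFrom⁺ r<))

      -- Sum `t≤2hk` over the unplaced vertices, insert `unplaced-links` and cancel `t`.
      few-unplaced : u ≤ (h + h) * ((h + h) * (Δ₂ * Δ₃) + R)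
      few-unplaced = *-cancelʳ-≤ u _ t {{>-nonZero t≥1}} (begin
        u * t                                              ≡⟨ ∑-*ʳ V ω t ⟨
        ∑ V (λ v → ω v * t)                                ≤⟨ ∑ω-mono t≤2hk ⟩
        ∑ V (λ v → ω v * ((h + h) * k v))                  ≡⟨ ∑-cong V (λ v → swap* (ω v) (h + h) (k v)) ⟩
        ∑ V (λ v → (h + h) * (ω v * k v))                  ≡⟨ ∑-*ˡ V (h + h) _ ⟩
        (h + h) * ∑ V (λ v → ω v * k v)                    ≤⟨ *-monoʳ-≤ (h + h) unplaced-links ⟩
        (h + h) * (t * ((h + h) * (Δ₂ * Δ₃) + R))          ≡⟨ trans (swap* (h + h) t _) (*-comm t _) ⟩
        (h + h) * ((h + h) * (Δ₂ * Δ₃) + R) * t            ∎)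
        where
        open ≤-Reasoning
        swap* : ∀ a b d → a * (b * d) ≡ b * (a * d)
        swap* = solve-∀

      -- `spacing`, applied to the positions linked to `v`, yields many isolated ones. Such a
      -- position is good unless its vertex is adjacent to `v`, which costs at most 2Δ₂Δ₃.
      many-good : ∀ v → ω v ≡ 1 → t * 2 ≤ h * (3 * k v + γ v + 2 * (Δ₂ * Δ₃))
      many-good v ωv = begin
        t * 2
          ≤⟨ spacing ⟩
        h * ∑ (downFrom t) (λ i → X v (i + h) * (3 + clearʳ v (i + h) * clearˡ v i))
          ≤⟨ *-monoʳ-≤ h (∑-mono (downFrom t) pointwise) ⟩
        h * ∑ (downFrom t) (λ i → 3 * μ t c v (c (i + h)) + good v i + adjacent v (c (i + h)))
          ≡⟨ cong (h *_) (trans (∑-+ (downFrom t) _ _) (cong (_+ ∑ (downFrom t) (λ i → adjacent v (c (i + h)))) (∑-+ (downFrom t) _ _))) ⟩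
        h * (∑ (downFrom t) (λ i → 3 * μ t c v (c (i + h))) + γ v + ∑ (downFrom t) (λ i → adjacent v (c (i + h))))
          ≡⟨ cong₂ (λ a b → h * (a + γ v + b)) (trans (∑-*ˡ (downFrom t) 3 _) (cong (3 *_) (placed-shift (μ t c v) h))) (placed-shift (adjacent v) h) ⟩
        h * (3 * k v + γ v + ∑ V (λ x → τ x * adjacent v x))
          ≤⟨ *-monoʳ-≤ h (+-monoʳ-≤ (3 * k v + γ v) few-adjacent) ⟩
        h * (3 * k v + γ v + 2 * (Δ₂ * Δ₃)) ∎
        where
        open ≤-Reasoning
        X-per : ∀ i → X v (i + t) ≡ X v i
        X-per i = cong (λ x → 1 ⊓ μ t c v x) (per i)
        hit : ∀ {j} → j < t → ∃ λ r → r < h + h × 1 ≤ X v (j + r)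
        hit j<t = let (r , r< , 1≤μ) = blocked v ωv j<t in r , r< , ⊓-glb ≤-refl 1≤μ
        open Spacing t h (X v) X-per hit using (spacing)
        few-adjacent : ∑ V (λ x → τ x * adjacent v x) ≤ 2 * (Δ₂ * Δ₃)
        few-adjacent = begin
          ∑ V (λ x → τ x * adjacent v x)                ≤⟨ ∑-mono V (λ x → *-monoˡ-≤ (adjacent v x) (τ≤1 x)) ⟩
          ∑ V (λ x → 1 * adjacent v x)                  ≡⟨ ∑-cong V (λ x → *-identityˡ _) ⟩
          ∑ V (adjacent v)                              ≡⟨ trans (∑-+ V _ _) (cong₂ _+_ (∑-*ˡ V Δ₃ (e₂ v)) (∑-*ˡ V Δ₂ (e₃ v))) ⟩
          Δ₃ * ∑ V (e₂ v) + Δ₂ * ∑ V (e₃ v)             ≤⟨ +-mono-≤ (*-monoʳ-≤ Δ₃ (deg₂ v)) (*-monoʳ-≤ Δ₂ (deg₃ v)) ⟩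
          Δ₃ * Δ₂ + Δ₂ * Δ₃                             ≡⟨ lem Δ₂ Δ₃ ⟩
          2 * (Δ₂ * Δ₃)                                 ∎
          where
          lem : ∀ a b → b * a + a * b ≡ 2 * (a * b)
          lem = solve-∀
        pointwise : ∀ i → X v (i + h) * (3 + clearʳ v (i + h) * clearˡ v i) ≤
                          3 * μ t c v (c (i + h)) + good v i + adjacent v (c (i + h))
        pointwise i = begin
          X v (i + h) * (3 + b)                         ≡⟨ *-distribˡ-+ (X v (i + h)) 3 b ⟩
          X v (i + h) * 3 + X v (i + h) * b             ≤⟨ +-mono-≤ (*-monoˡ-≤ 3 (X≤μ v (i + h))) rest ⟩
          μ t c v (c (i + h)) * 3 + (good v i + a)      ≡⟨ cong (_+ (good v i + a)) (*-comm (μ t c v (c (i + h))) 3) ⟩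
          3 * μ t c v (c (i + h)) + (good v i + a)      ≡⟨ +-assoc (3 * μ t c v (c (i + h))) _ _ ⟨
          3 * μ t c v (c (i + h)) + good v i + a        ∎
          where
          a b : ℕ
          a = adjacent v (c (i + h))
          b = clearʳ v (i + h) * clearˡ v i
          either : ∀ y n → y ≤ 1 → y ≤ y * (1 ∸ n) + n
          either y zero    _   = ≤-reflexive (sym (trans (+-identityʳ _) (*-identityʳ y)))
          either y (suc n) y≤1 = ≤-trans y≤1 (≤-trans (s≤s z≤n) (m≤n+m (suc n) (y * (1 ∸ suc n))))
          rest : X v (i + h) * b ≤ good v i + a
          rest = either (X v (i + h) * b) a (*-mono-≤ (X≤1 v (i + h)) (clear≤1 v i))

      module _ (optimal : ∀ v i → i < t → ω v ≡ 1 → 1 ≤ good v i →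
                 l (c (i + h)) + k v ≤ 4 * h * (Δ₂ * Δ₃) + R + μ t c v (c (i + h))) where

        q : ℕ → ℕ
        q i = ∑ V (λ v → ω v * good v i)

        -- Put x = c (i + h). All `q i` vertices are linked to x, and `v` contributes at most 1 to
        -- `q i` but μ(v,x) to `l x`; so q i + μ(v,x) ≤ l x + 1. Adding `optimal` cancels μ(v,x).
        q-bound : ∀ v i → i < t → ω v ≡ 1 → 1 ≤ good v i → q i + k v ≤ Λ
        q-bound v i i<t ωv gv = +-cancelʳ-≤ (μ t c v x) _ _ (begin
          q i + k v + μ t c v x                                  ≡⟨ s₁ (q i) (k v) (μ t c v x) ⟩
          q i + μ t c v x + k v                                  ≤⟨ +-monoˡ-≤ (k v) q+μ ⟩
          l x + 1 + k v                                          ≡⟨ s₁ (l x) 1 (k v) ⟩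
          l x + k v + 1                                          ≤⟨ +-monoˡ-≤ 1 (optimal v i i<t ωv gv) ⟩
          4 * h * (Δ₂ * Δ₃) + R + μ t c v x + 1                  ≡⟨ s₁ (4 * h * (Δ₂ * Δ₃) + R) (μ t c v x) 1 ⟩
          Λ + μ t c v x                                          ∎)
          where
          open ≤-Reasoning
          x : Fin m
          x = c (i + h)
          s₁ : ∀ a b d → a + b + d ≡ a + d + b
          s₁ = solve-∀
          pointwise : ∀ z → ω z * good z i + δ v z * μ t c v x ≤ ω z * μ t c x z + δ v z * 1
          pointwise z with v ≟ᶠ z
          ... | yes refl rewrite ωv = begin
            1 * good v i + 1 * μ t c v x       ≡⟨ cong₂ _+_ (*-identityˡ (good v i)) (cong (1 *_) (μ-sym t c v x)) ⟩
            good v i + 1 * μ t c x v           ≤⟨ +-monoˡ-≤ (1 * μ t c x v) (good≤1 v i) ⟩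
            1 + 1 * μ t c x v                  ≡⟨ +-comm 1 _ ⟩
            1 * μ t c x v + 1                  ∎
          ... | no _     = +-monoˡ-≤ 0 (*-monoʳ-≤ (ω z) (≤-trans (good≤μ z i) (≤-reflexive (μ-sym t c z x))))
          q+μ : q i + μ t c v x ≤ l x + 1
          q+μ = begin
            q i + μ t c v x                                                ≡⟨ cong (q i +_) (∑-δ v (λ _ → μ t c v x)) ⟨
            q i + ∑ V (λ z → δ v z * μ t c v x)                            ≡⟨ ∑-+ V _ _ ⟨
            ∑ V (λ z → ω z * good z i + δ v z * μ t c v x)                 ≤⟨ ∑-mono V pointwise ⟩
            ∑ V (λ z → ω z * μ t c x z + δ v z * 1)                        ≡⟨ ∑-+ V _ _ ⟩
            l x + ∑ V (λ z → δ v z * 1)                                    ≡⟨ cong (l x +_) (∑-δ v (λ _ → 1)) ⟩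
            l x + 1                                                        ∎

        M : ℕ
        M = Λ !

        -- The weight 1/p, scaled by the common multiple `M` of 1, ..., Λ to stay integral. The
        -- value at `zero` is a default, as all deficits are positive.
        weight : ℕ → ℕ
        weight zero    = 0
        weight (suc p) = M / suc p

        weight-* : ∀ {p} → 1 ≤ p → p ≤ Λ → p * weight p ≡ M
        weight-* {suc p} _ p≤Λ = trans (*-comm (suc p) _) (m/n*n≡m (∣-trans (m∣m*n (p !)) (m≤n⇒m!∣n! p≤Λ)))

        deficit : Fin m → ℕ
        deficit v = Λ ∸ k v

        -- The final 1 in `Λ` makes the inequality strict, so no deficit is 0.
        k<Λ : ∀ v → suc (k v) ≤ Λ
        k<Λ v = subst (suc (k v) ≤_) (+-comm 1 _) (s≤s (≤-trans (≤-trans (m≤m+n (k v) (l v)) (m≤m+n _ _)) (links-bound v)))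

        deficit-+ : ∀ v → deficit v + k v ≡ Λ
        deficit-+ v = m∸n+n≡m (<⇒≤ (k<Λ v))

        deficit-weight : ∀ v → deficit v * weight (deficit v) ≡ M
        deficit-weight v = weight-* (m<n⇒0<n∸m (k<Λ v)) (m∸n≤m Λ (k v))

        -- By `q-bound` each of the `q i` vertices that can be exchanged here has deficit at least
        -- `q i`, hence weight at most M / q i.
        position-bound : ∀ {i} → i < t → ∑ V (λ v → ω v * (good v i * weight (deficit v))) ≤ M
        position-bound {i} i<t with q i in eq
        ... | zero  = ≤-trans (≤-reflexive (trans (∑-cong-∈ V vanish) (trans (∑-const V 0) (*-zeroʳ (length V))))) z≤n
          where
          vanish : ∀ {v} → v ∈ V → ω v * (good v i * weight (deficit v)) ≡ 0
          vanish {v} v∈ = trans (sym (*-assoc (ω v) (good v i) _))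
            (cong (_* weight (deficit v)) (∑≡0⇒ (λ v → ω v * good v i) eq v∈))
        ... | suc Q = *-cancelˡ-≤ (suc Q) (begin
          suc Q * ∑ V (λ v → ω v * (good v i * weight (deficit v)))          ≡⟨ ∑-*ˡ V (suc Q) _ ⟨
          ∑ V (λ v → suc Q * (ω v * (good v i * weight (deficit v))))        ≡⟨ ∑-cong V (λ v → swap* (suc Q) (ω v) (good v i) _) ⟩
          ∑ V (λ v → ω v * (good v i * (suc Q * weight (deficit v))))        ≤⟨ ∑ω-mono le ⟩
          ∑ V (λ v → ω v * (good v i * M))                                   ≡⟨ ∑-cong V (λ v → sym (*-assoc (ω v) (good v i) M)) ⟩
          ∑ V (λ v → ω v * good v i * M)                                     ≡⟨ ∑-*ʳ V _ M ⟩
          q i * M                                                            ≡⟨ cong (_* M) eq ⟩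
          suc Q * M                                                          ∎)
          where
          open ≤-Reasoning
          swap* : ∀ a b d e → a * (b * (d * e)) ≡ b * (d * (a * e))
          swap* = solve-∀
          le : ∀ v → ω v ≡ 1 → good v i * (suc Q * weight (deficit v)) ≤ good v i * M
          le v ωv with good v i in geq
          ... | zero  = z≤n
          ... | suc g = *-monoʳ-≤ (suc g) (≤-trans (*-monoˡ-≤ (weight (deficit v)) Q≤) (≤-reflexive (deficit-weight v)))
            where
            Q≤ : suc Q ≤ deficit v
            Q≤ = m+n≤o⇒m≤o∸n (suc Q) (subst (λ n → n + k v ≤ Λ) eq (q-bound v i i<t ωv (subst (1 ≤_) (sym geq) (s≤s z≤n))))

        total-bound : ∑ V (λ v → ω v * (γ v * weight (deficit v))) ≤ t * M
        total-bound = begin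
          ∑ V (λ v → ω v * (γ v * weight (deficit v)))
            ≡⟨ ∑-cong V (λ v → trans (cong (ω v *_) (sym (∑-*ʳ (downFrom t) (good v) _))) (sym (∑-*ˡ (downFrom t) (ω v) _))) ⟩
          ∑ V (λ v → ∑ (downFrom t) (λ i → ω v * (good v i * weight (deficit v))))
            ≡⟨ ∑-swap V (downFrom t) _ ⟩
          ∑ (downFrom t) (λ i → ∑ V (λ v → ω v * (good v i * weight (deficit v))))
            ≤⟨ ∑-mono-∈ (downFrom t) (λ i∈ → position-bound (∈-downFrom⁻ i∈)) ⟩
          ∑ (downFrom t) (λ _ → M)
            ≡⟨ trans (∑-const (downFrom t) M) (cong (_* M) (length-downFrom t)) ⟩
          t * M ∎
          where open ≤-Reasoning

        -- Every unplaced vertex has at least three times its deficit of good positions, with an excess that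
        -- grows with t; the harmonic weights M / deficit turn this into a lower bound on t.
        weighted-count : ∀ e p′ → 1 ≤ h → 3 * h * Λ + 2 * h * (Δ₂ * Δ₃) + e ≡ t * 2 → p′ + t ≡ 2 * h * Λ →
                         u * (3 * p′ + 2 * e) ≤ p′ * t
        weighted-count e p′ h≥1 e-def p′-def = *-cancelʳ-≤ _ _ (h * M) {{>-nonZero (*-mono-≤ h≥1 (1≤n! Λ))}} (begin
          u * (3 * p′ + 2 * e) * (h * M)
            ≡⟨ *-assoc u _ _ ⟩
          u * ((3 * p′ + 2 * e) * (h * M))
            ≡⟨ ∑-*ʳ V ω _ ⟨
          ∑ V (λ v → ω v * ((3 * p′ + 2 * e) * (h * M)))
            ≤⟨ ∑ω-mono single ⟩
          ∑ V (λ v → ω v * (p′ * (h * (γ v * weight (deficit v)))))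
            ≡⟨ ∑-cong V (λ v → s₁ (ω v) p′ h (γ v * weight (deficit v))) ⟩
          ∑ V (λ v → p′ * h * (ω v * (γ v * weight (deficit v))))
            ≡⟨ ∑-*ˡ V (p′ * h) _ ⟩
          p′ * h * ∑ V (λ v → ω v * (γ v * weight (deficit v)))
            ≤⟨ *-monoʳ-≤ (p′ * h) total-bound ⟩
          p′ * h * (t * M)
            ≡⟨ s₂ p′ h t M ⟩
          p′ * t * (h * M) ∎)
          where
          open ≤-Reasoning
          s₁ : ∀ a b d e → a * (b * (d * e)) ≡ b * d * (a * e)
          s₁ = solve-∀
          s₂ : ∀ a b d e → a * b * (d * e) ≡ a * d * (b * e)
          s₂ = solve-∀
          single : ∀ v → ω v ≡ 1 → (3 * p′ + 2 * e) * (h * M) ≤ p′ * (h * (γ v * weight (deficit v)))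
          single v ωv = begin
            (3 * p′ + 2 * e) * (h * M)                     ≡⟨ cong (λ n → (3 * p′ + 2 * e) * (h * n)) (deficit-weight v) ⟨
            (3 * p′ + 2 * e) * (h * (p * w))               ≡⟨ s₃ p′ e h p w ⟩
            -- The share of `e` in the weighted count is e/p, so the largest deficit is the worst
            -- case; by `t≤2hk` it is at most p′/(2h).
            p′ * (3 * h * p) * w + e * (2 * h * p) * w     ≤⟨ +-monoʳ-≤ (p′ * (3 * h * p) * w) (*-monoˡ-≤ w (*-monoʳ-≤ e 2hp≤p′)) ⟩
            p′ * (3 * h * p) * w + e * p′ * w              ≡⟨ s₄ p′ (3 * h * p) w e ⟩
            p′ * w * (3 * h * p + e)                       ≤⟨ *-monoʳ-≤ (p′ * w) excess ⟩
            p′ * w * (h * γ v)                             ≡⟨ s₅ p′ w h (γ v) ⟩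
            p′ * (h * (γ v * w))                           ∎
            where
            p w : ℕ
            p = deficit v
            w = weight p
            s₃ : ∀ a e h p w → (3 * a + 2 * e) * (h * (p * w)) ≡ a * (3 * h * p) * w + e * (2 * h * p) * w
            s₃ = solve-∀
            s₄ : ∀ a b w e → a * b * w + e * a * w ≡ a * w * (b + e)
            s₄ = solve-∀
            s₅ : ∀ a w h g → a * w * (h * g) ≡ a * (h * (g * w))
            s₅ = solve-∀
            2hp≤p′ : 2 * h * p ≤ p′
            2hp≤p′ = +-cancelʳ-≤ t _ _ (begin
              2 * h * p + t                  ≤⟨ +-monoʳ-≤ (2 * h * p) (t≤2hk v ωv) ⟩
              2 * h * p + (h + h) * k v      ≡⟨ s₆ h p (k v) ⟩
              2 * h * (p + k v)              ≡⟨ cong (2 * h *_) (deficit-+ v) ⟩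
              2 * h * Λ                      ≡⟨ p′-def ⟨
              p′ + t                         ∎)
              where
              s₆ : ∀ h p k → 2 * h * p + (h + h) * k ≡ 2 * h * (p + k)
              s₆ = solve-∀
            excess : 3 * h * p + e ≤ h * γ v
            excess = +-cancelʳ-≤ (3 * h * k v + 2 * h * (Δ₂ * Δ₃)) _ _ (begin
              3 * h * p + e + (3 * h * k v + 2 * h * (Δ₂ * Δ₃))     ≡⟨ s₇ h p e (k v) (Δ₂ * Δ₃) ⟩
              3 * h * (p + k v) + 2 * h * (Δ₂ * Δ₃) + e             ≡⟨ cong (λ n → 3 * h * n + 2 * h * (Δ₂ * Δ₃) + e) (deficit-+ v) ⟩
              3 * h * Λ + 2 * h * (Δ₂ * Δ₃) + e                     ≡⟨ e-def ⟩
              t * 2                                                 ≤⟨ many-good v ωv ⟩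
              h * (3 * k v + γ v + 2 * (Δ₂ * Δ₃))                   ≡⟨ s₈ h (k v) (γ v) (Δ₂ * Δ₃) ⟩
              h * γ v + (3 * h * k v + 2 * h * (Δ₂ * Δ₃))           ∎)
              where
              s₇ : ∀ h p e k d → 3 * h * p + e + (3 * h * k + 2 * h * d) ≡ 3 * h * (p + k) + 2 * h * d + e
              s₇ = solve-∀
              s₈ : ∀ h k g d → h * (3 * k + g + 2 * d) ≡ h * g + (3 * h * k + 2 * h * d)
              s₈ = solve-∀

        -- In t · m = ut + t² the first factor t is split by `t-split`. Then `weighted-count` and u
        -- ≤ t bound the right-hand side by t(2hΛ + 4hD), so m ≤ 2hΛ + 4hD, against the threshold.
        impossible : ∀ v → ω v ≡ 1 → 1 ≤ h → threshold ≤ m → ⊥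
        impossible v ωv h≥1 large = <⇒≱ small (*-cancelˡ-≤ t {{>-nonZero t≥1}} (begin
          t * m                                               ≡⟨ cong (t *_) placed+unplaced ⟨
          t * (t + u)                                         ≡⟨ n₁ t u ⟩
          u * t + t * t                                       ≡⟨ cong (λ n → u * n + t * t) t-split ⟩
          u * (3 * p′ + 2 * e + 4 * h * D) + t * t            ≡⟨ n₂ u (3 * p′ + 2 * e) (4 * h * D) (t * t) ⟩
          u * (3 * p′ + 2 * e) + (t * t + 4 * h * D * u)      ≤⟨ +-mono-≤ (weighted-count e p′ h≥1 e-def p′-def) (+-monoʳ-≤ (t * t) (*-monoʳ-≤ (4 * h * D) u≤t)) ⟩
          p′ * t + (t * t + 4 * h * D * t)                    ≡⟨ n₃ p′ t (4 * h * D) ⟩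
          t * (p′ + t + 4 * h * D)                            ≡⟨ cong (λ n → t * (n + 4 * h * D)) p′-def ⟩
          t * (2 * h * Λ + 4 * h * D)                         ∎))
          where
          open ≤-Reasoning
          D p′ e : ℕ
          D = Δ₂ * Δ₃
          p′ = 2 * h * Λ ∸ t
          e = t * 2 ∸ (3 * h * Λ + 2 * h * D)
          n₁ : ∀ t u → t * (t + u) ≡ u * t + t * t
          n₁ = solve-∀
          n₂ : ∀ u a b s → u * (a + b) + s ≡ u * a + (s + b * u)
          n₂ = solve-∀
          n₃ : ∀ p t b → p * t + (t * t + b * t) ≡ t * (p + t + b)
          n₃ = solve-∀
          -- In `lem` the second summand is the amount by which the threshold exceeds the bound, a
          -- polynomial with nonnegative coefficients; likewise in `u≤t` and, for twice the
          -- threshold, in `enough`.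
          small : 2 * h * Λ + 4 * h * D < m
          small = ≤-trans (m≤m+n _ _) (≤-trans (≤-reflexive (lem h D R)) large)
            where
            lem : ∀ h D R → suc (2 * h * (4 * h * D + R + 1) + 4 * h * D) +
                    (2 * h * h * D + 11 * h * D + 5 * D + (4 * h * h + 2 * h + 1) * R + 2 * h + 1) ≡
                  4 * h + 2 + 5 * (h + 1) * (2 * h + 1) * D + (2 * h + 1) * (2 * h + 1) * R
            lem = solve-∀
          u≤t : u ≤ t
          u≤t = +-cancelʳ-≤ u _ _ (begin
            u + u                                                              ≤⟨ +-mono-≤ few-unplaced few-unplaced ⟩
            (h + h) * ((h + h) * D + R) + (h + h) * ((h + h) * D + R)          ≤⟨ m≤m+n _ _ ⟩
            _                                                                  ≡⟨ lem h D R ⟩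
            _                                                                  ≤⟨ large ⟩
            m                                                                  ≡⟨ placed+unplaced ⟨
            t + u                                                              ∎)
            where
            lem : ∀ h D R → (h + h) * ((h + h) * D + R) + (h + h) * ((h + h) * D + R) +
                    (2 * h * h * D + 15 * h * D + 5 * D + (4 * h * h + 1) * R + 4 * h + 2) ≡
                  4 * h + 2 + 5 * (h + 1) * (2 * h + 1) * D + (2 * h + 1) * (2 * h + 1) * R
            lem = solve-∀
          -- This makes the subtraction in `e` exact, as `t≤` does for `p′`.
          enough : 3 * h * Λ + 2 * h * D ≤ t * 2
          enough = +-cancelʳ-≤ (u * 2) _ _ (begin
            3 * h * Λ + 2 * h * D + u * 2                                      ≤⟨ +-monoʳ-≤ (3 * h * Λ + 2 * h * D) (*-monoˡ-≤ 2 few-unplaced) ⟩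
            3 * h * Λ + 2 * h * D + (h + h) * ((h + h) * D + R) * 2            ≤⟨ m≤m+n _ _ ⟩
            _                                                                  ≡⟨ lem h D R ⟩
            (4 * h + 2 + 5 * (h + 1) * (2 * h + 1) * D + (2 * h + 1) * (2 * h + 1) * R) * 2
                                                                               ≤⟨ *-monoˡ-≤ 2 large ⟩
            m * 2                                                              ≡⟨ cong (_* 2) placed+unplaced ⟨
            (t + u) * 2                                                        ≡⟨ *-distribʳ-+ 2 t u ⟩
            t * 2 + u * 2                                                      ∎)
            where
            lem : ∀ h D R → 3 * h * (4 * h * D + R + 1) + 2 * h * D + (h + h) * ((h + h) * D + R) * 2 +
                    (5 * h + 4 + (28 * h + 10) * D + (8 * h * h + h + 2) * R) ≡
                  (4 * h + 2 + 5 * (h + 1) * (2 * h + 1) * D + (2 * h + 1) * (2 * h + 1) * R) * 2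
            lem = solve-∀
          e-def : 3 * h * Λ + 2 * h * D + e ≡ t * 2
          e-def = m+[n∸m]≡n enough
          t≤ : t ≤ 2 * h * Λ
          t≤ = begin
            t                 ≤⟨ t≤2hk v ωv ⟩
            (h + h) * k v     ≤⟨ *-monoʳ-≤ (h + h) (<⇒≤ (k<Λ v)) ⟩
            (h + h) * Λ       ≡⟨ cong (λ n → (h + n) * Λ) (+-identityʳ h) ⟨
            2 * h * Λ         ∎
          p′-def : p′ + t ≡ 2 * h * Λ
          p′-def = m∸n+n≡m t≤
          -- Elimination of hΛ from the equations `e-def` and `p′-def`.
          t-split : t ≡ 3 * p′ + 2 * e + 4 * h * D
          t-split = +-cancelʳ-≡ (3 * t) _ _ (begin-equality
            t + 3 * t                                              ≡⟨ n₄ t ⟩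
            2 * (t * 2)                                            ≡⟨ cong (2 *_) e-def ⟨
            2 * (3 * h * Λ + 2 * h * D + e)                        ≡⟨ n₅ h Λ D e ⟩
            3 * (2 * h * Λ) + (2 * e + 4 * h * D)                  ≡⟨ cong (λ n → 3 * n + (2 * e + 4 * h * D)) p′-def ⟨
            3 * (p′ + t) + (2 * e + 4 * h * D)                     ≡⟨ n₆ p′ t (2 * e) (4 * h * D) ⟩
            3 * p′ + 2 * e + 4 * h * D + 3 * t                     ∎)
            where
            n₄ : ∀ t → t + 3 * t ≡ 2 * (t * 2)
            n₄ = solve-∀
            n₅ : ∀ h L D e → 2 * (3 * h * L + 2 * h * D + e) ≡ 3 * (2 * h * L) + (2 * e + 4 * h * D)
            n₅ = solve-∀
            n₆ : ∀ p t a b → 3 * (p + t) + (a + b) ≡ 3 * p + a + b + 3 * t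
            n₆ = solve-∀

  -- Finding an improving move

  module Step (P : Arrangement m) (conflictFree : ConflictFree (Arrangement.t P) (Arrangement.c P)) where
    open Arrangement P
    open Counting P
    open Periodic P
    open Stuck P

    placed : ∀ i → ω (c i) ≡ 0
    placed i with ω-cases (c i)
    ... | inj₁ ω≡0 = ω≡0
    ... | inj₂ ω≡1 = ⊥-elim (unplaced⇒≢ ω≡1 i refl)

    -- A positive product has positive factors, and a positive `1 ∸ n` forces `n` to be 0. So a good
    -- position meets the conditions of `exchange-good` and `exchange-bound`.
    good-cleared : ∀ {v i} → 1 ≤ good v i →
      (∀ {s} → s < h → μ t c v (c (i + h + suc s)) ≡ 0) × (∀ {s} → s < h → μ t c v (c (i + s)) ≡ 0) ×
      adjacent v (c (i + h)) ≡ 0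
    good-cleared {v} {i} 1≤g =
        (λ s<h → unmarked (∑≡0⇒ (λ s → X v (i + h + suc s)) (zero∸ (factorˡ cleared)) (∈-downFrom⁺ s<h)))
      , (λ s<h → unmarked (∑≡0⇒ (λ s → X v (i + s)) (zero∸ (factorʳ {clearʳ v (i + h)} cleared)) (∈-downFrom⁺ s<h)))
      , zero∸ (factorʳ {X v (i + h) * (clearʳ v (i + h) * clearˡ v i)} 1≤g)
      where
      factorˡ : ∀ {a b} → 1 ≤ a * b → 1 ≤ a
      factorˡ {suc a} _ = s≤s z≤n
      factorʳ : ∀ {a b} → 1 ≤ a * b → 1 ≤ b
      factorʳ {a} {b} 1≤ab = factorˡ {b} {a} (subst (1 ≤_) (*-comm a b) 1≤ab)
      zero∸ : ∀ {n} → 1 ≤ 1 ∸ n → n ≡ 0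
      zero∸ {zero}  _ = refl
      zero∸ {suc n} p = ⊥-elim (<⇒≱ p (≤-reflexive (0∸n≡0 n)))
      unmarked : ∀ {n} → 1 ⊓ n ≡ 0 → n ≡ 0
      unmarked {zero} _ = refl
      cleared : 1 ≤ clearʳ v (i + h) * clearˡ v i
      cleared = factorʳ {X v (i + h)} (factorˡ 1≤g)

    Insertable Exchangeable : Fin m × ℕ → Set
    Insertable (v , j) = ω v ≡ 1 × ∑ (downFrom (h + h)) (λ r → μ t c v (c (j + r))) ≡ 0
    Exchangeable (v , i) = Σ (ω v ≡ 1) λ ωv → 1 ≤ good v i ×
      Φ t c ω < Φ t (Exchange.σ P v (c (i + h)) ωv (placed (i + h)) ∘ c) (Exchange.ω′ P v (c (i + h)) ωv (placed (i + h)))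

    insertable? : ∀ p → Dec (Insertable p)
    insertable? (v , j) = (ω v ≟ 1) ×-dec (_ ≟ 0)

    exchangeable? : ∀ p → Dec (Exchangeable p)
    exchangeable? (v , i) with ω v ≟ 1
    ... | no ω≢1 = no (ω≢1 ∘ proj₁)
    -- The exchanged arrangement mentions the proof of `ω v ≡ 1`, so a given witness is transported
    -- to the proof at hand.
    ... | yes ωv = map′ (ωv ,_) (λ (ωv′ , rest) → subst Rest (≡-irrelevant ωv′ ωv) rest) ((1 ≤? good v i) ×-dec (_ <? _))
      where
      Rest : ω v ≡ 1 → Set
      Rest ωv = 1 ≤ good v i × Φ t c ω <
        Φ t (Exchange.σ P v (c (i + h)) ωv (placed (i + h)) ∘ c) (Exchange.ω′ P v (c (i + h)) ωv (placed (i + h)))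

    candidates : List (Fin m × ℕ)
    candidates = cartesianProduct V (downFrom t)

    candidate : ∀ v {i} → i < t → (v , i) ∈ candidates
    candidate v i<t = ∈-cartesianProduct⁺ (∈-allFin v) (∈-downFrom⁺ i<t)

    -- A finite search for a clear window and then for an exchange that raises `Φ`. If both fail,
    -- the failures are the hypotheses `blocked` and `optimal` of `impossible`.
    step : ∀ {v} → ω v ≡ 1 → 1 ≤ h → threshold ≤ m →
      (Σ (Arrangement m) λ Q → ConflictFree (Arrangement.t Q) (Arrangement.c Q) × Arrangement.t Q ≡ suc t) ⊎
      (Σ (Arrangement m) λ Q → ConflictFree (Arrangement.t Q) (Arrangement.c Q) × Arrangement.t Q ≡ t ×
                               Φ t c ω < Φ (Arrangement.t Q) (Arrangement.c Q) (Arrangement.ω Q))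
    step {v₀} ωv₀ h≥1 large with any? insertable? candidates
    ... | yes found = let ((v , j) , _ , ωv , clear) = find found in
      inj₁ (Insert.insert v ωv j , Insert.insert-good v ωv j (λ r< → ∑≡0⇒ (λ r → μ t c v (c (j + r))) clear (∈-downFrom⁺ r<)) conflictFree , refl)
    ... | no ¬insertable with any? exchangeable? candidates
    ...   | yes found = let ((v , i) , _ , ωv , 1≤g , Φ<) = find found
                            (clear , clear′ , _) = good-cleared 1≤g in
      inj₂ (Exchange.exchange P v (c (i + h)) ωv (placed (i + h)) , exchange-good ωv (placed (i + h)) i refl clear clear′ conflictFree , refl , Φ<)
    ...   | no ¬exchangeable = ⊥-elim (impossible blocked optimal v₀ ωv₀ h≥1 large)
      where
      blocked : ∀ v → ω v ≡ 1 → ∀ {j} → j < t → ∃ λ r → r < h + h × 1 ≤ μ t c v (c (j + r))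
      blocked v ωv {j} j<t =
        let (r , r∈ , 1≤μ) = ∑≥1⇒∃ (downFrom (h + h)) (λ r → μ t c v (c (j + r)))
                               (n≢0⇒n>0 λ ≡0 → ¬insertable (lose (candidate v j<t) (ωv , ≡0)))
        in r , ∈-downFrom⁻ r∈ , 1≤μ
      optimal : ∀ v i → i < t → ω v ≡ 1 → 1 ≤ good v i →
                 l (c (i + h)) + k v ≤ 4 * h * (Δ₂ * Δ₃) + R + μ t c v (c (i + h))
      optimal v i i<t ωv 1≤g = Exchange.exchange-bound P v (c (i + h)) ωv (placed (i + h)) (proj₂ (proj₂ (good-cleared {v} {i} 1≤g)))
        (≮⇒≥ λ Φ< → ¬exchangeable (lose (candidate v i<t) (ωv , 1≤g , Φ<)))

  -- Iteration up to a full arrangement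

  Φ-max : ℕ
  Φ-max = 2 * ((h + h) * ∑ V (λ _ → Δ₂ * Δ₃)) + ∑ V (λ a → ∑ V (ρ a))

  -- The bound is the same for all arrangements, so between two insertions only finitely many
  -- exchanges raise `Φ`.
  Φ-bounded : (P : Arrangement m) → Φ (Arrangement.t P) (Arrangement.c P) (Arrangement.ω P) ≤ Φ-max
  Φ-bounded P = +-mono-≤ (*-monoʳ-≤ 2 (begin
      near∑ t c (λ y z → wt ω e₂ y * wt ω e₃ z)  ≤⟨ near∑-mono (λ y z → *-mono-≤ (≤deg e₂ deg₂ y) (≤deg e₃ deg₃ z)) ⟩
      near∑ t c (λ _ _ → Δ₂ * Δ₃)                ≡⟨ near∑₁ (λ _ → Δ₂ * Δ₃) ⟩
      (h + h) * ∑ V (λ v → τ v * (Δ₂ * Δ₃))      ≤⟨ *-monoʳ-≤ (h + h) (∑-mono V λ v → scale (Δ₂ * Δ₃) (τ≤1 v)) ⟩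
      (h + h) * ∑ V (λ _ → Δ₂ * Δ₃)              ∎))
    (∑-mono V λ a → scale* (ω≤1 a) (∑-mono V λ b → scale (ρ a b) (ω≤1 b)))
    where
    open ≤-Reasoning
    open Arrangement P
    open Counting P
    open Periodic P using (τ≤1)
    open Stuck P using (ω≤1)
    scale : ∀ {a} n → a ≤ 1 → a * n ≤ n
    scale n a≤1 = ≤-trans (*-monoˡ-≤ n a≤1) (≤-reflexive (*-identityˡ n))
    scale* : ∀ {a n n′} → a ≤ 1 → n ≤ n′ → a * n ≤ n′
    scale* {n = n} a≤1 n≤ = ≤-trans (scale n a≤1) n≤
    ≤deg : ∀ {Δ} e → (∀ a → ∑ V (e a) ≤ Δ) → ∀ y → wt ω e y ≤ Δ
    ≤deg e deg y = ≤-trans (∑-mono V λ x → scale (e y x) (ω≤1 x)) (deg y)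

  module Complete (h≥1 : 1 ≤ h) (large : threshold ≤ m) where

    Result : ℕ → Set
    Result n = Σ (Arrangement m) λ Q → ConflictFree (Arrangement.t Q) (Arrangement.c Q) × Arrangement.t Q ≡ n

    -- The fuel bounds how far `Φ` can still rise: each exchange spends one unit and raises `Φ` by
    -- at least one. With none left, `Φ` would exceed `Φ-max`.
    grow : ∀ fuel (P : Arrangement m) → ConflictFree (Arrangement.t P) (Arrangement.c P) → Arrangement.t P < m →
           Φ-max < Φ (Arrangement.t P) (Arrangement.c P) (Arrangement.ω P) + fuel → Result (suc (Arrangement.t P))
    grow zero P cf t<m Φ< = ⊥-elim (<⇒≱ Φ< (≤-trans (≤-reflexive (+-identityʳ _)) (Φ-bounded P)))
    grow (suc fuel) P cf t<m Φ<
      with v , _ , 1≤ω ← ∑≥1⇒∃ V (Arrangement.ω P) (+-cancelˡ-≤ (Arrangement.t P) _ _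
             (≤-trans (≤-reflexive (+-comm (Arrangement.t P) 1)) (≤-trans t<m (≤-reflexive (sym (Counting.placed+unplaced P))))))
      with Step.step P cf (≤-antisym (Stuck.ω≤1 P v) 1≤ω) h≥1 large
    ... | inj₁ grown = grown
    ... | inj₂ (Q , cf′ , t≡ , Φ↑) = subst (Result ∘ suc) t≡ (grow fuel Q cf′ (subst (_< m) (sym t≡) t<m)
            (<-≤-trans Φ< (≤-trans (≤-reflexive (+-suc _ fuel)) (+-monoˡ-≤ fuel Φ↑))))

    complete : ∀ n (P : Arrangement m) → ConflictFree (Arrangement.t P) (Arrangement.c P) → Arrangement.t P + n ≡ m → Result m
    complete zero    P cf t≡m = P , cf , trans (sym (+-identityʳ _)) t≡m
    complete (suc n) P cf t+n≡m =
      let (Q , cf′ , t≡) = grow (suc Φ-max) P cf (subst (Arrangement.t P <_) t+n≡m (m<m+n _ (s≤s z≤n))) (m≤n+m _ _)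
      in complete n Q cf′ (trans (cong (_+ n) t≡) (trans (sym (+-suc _ n)) t+n≡m))

    singleton : Fin m → Arrangement m
    singleton v = record
      { t = 1 ; t≥1 = ≤-refl ; c = λ _ → v ; per = λ _ → refl ; ω = λ z → 1 ∸ δ v z ; part = part }
      where
      part : ∀ z → δ v z + 0 + (1 ∸ δ v z) ≡ 1
      part z with v ≟ᶠ z
      ... | yes _ = refl
      ... | no _  = refl

    conflictFreeArrangement : Fin m → Result m
    conflictFreeArrangement v = complete (m ∸ 1) (singleton v) (record
      { pair = λ n → ⊥-elim (¬near n) ; quad = λ n → ⊥-elim (¬near n) })
      (m+[n∸m]≡n (≤-trans (≤-trans (s≤s z≤n) (m≤n+m 2 (4 * h))) (≤-trans (m≤m+n _ _) (≤-trans (m≤m+n _ _) large))))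
      where
      -- A single vertex has no near pairs, since no offset satisfies 1 ≤ r < 1.
      ¬near : ∀ {x y} → ¬ Near 1 (λ _ → v) x y
      ¬near (inj₁ (_ , _ , 1≤r , _ , r<1 , _)) = <⇒≱ r<1 1≤r
      ¬near (inj₂ (_ , _ , 1≤r , _ , r<1 , _)) = <⇒≱ r<1 1≤r

  -- From a full arrangement to a Hamiltonian cycle

  module Cycle (P : Arrangement m) (t≡m : Arrangement.t P ≡ m) (3≤m : 3 ≤ m) where
    open Arrangement P
    open Periodic P using (injective)
    open Counting P using (τ; placed+unplaced)

    toℕ<t : (i : Fin m) → toℕ i < t
    toℕ<t i = subst (toℕ i <_) (sym t≡m) (toℕ<n i)

    surjective : ∀ v → ∃ λ (i : Fin m) → c (toℕ i) ≡ v
    surjective v with ∑≥1⇒∃ (downFrom t) (λ i → δ (c i) v) (≤-reflexive (sym τ≡1))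
      where
      ∑ω≡0 : ∑ (allFin m) ω ≡ 0
      ∑ω≡0 = +-cancelˡ-≡ t _ _ (trans placed+unplaced (trans (sym t≡m) (sym (+-identityʳ t))))
      τ≡1 : τ v ≡ 1
      τ≡1 = trans (sym (+-identityʳ _)) (trans (cong (τ v +_) (sym (∑≡0⇒ ω ∑ω≡0 (∈-allFin v)))) (part v))
    ... | i , i∈ , 1≤δ = fromℕ< i<m , trans (cong c (toℕ-fromℕ< i<m)) (equal (c i ≟ᶠ v) 1≤δ)
      where
      i<m : i < m
      i<m = subst (i <_) t≡m (∈-downFrom⁻ i∈)
      equal : Dec (c i ≡ v) → 1 ≤ δ (c i) v → c i ≡ v
      equal (yes ci≡v) _ = ci≡v
      equal (no ci≢v)  p = ⊥-elim (<⇒≱ p (≤-reflexive (δ-≢ ci≢v)))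

    H : HamCycle m
    H = record
      { three≤m = 3≤m
      ; vtx     = c ∘ toℕ
      ; vtx-inj = λ eq → toℕ-injective (injective (toℕ<t _) (toℕ<t _) eq)
      ; vtx-sur = surjective }

    -- The minimum in the cyclic distance is attained either by going forward from i to j or by
    -- going from j across the end of the period to i + t.
    ordered : ∀ {i j} → i < j → j < t → (j ∸ i) ⊓ (m ∸ (j ∸ i)) ≤ h → Near t c (c i) (c j)
    ordered {i} {j} i<j j<t dist with ⊓-sel (j ∸ i) (m ∸ (j ∸ i))
    ... | inj₁ eq = inj₁ (i , j ∸ i , m<n⇒0<n∸m i<j , subst (_≤ h) eq dist , ≤-<-trans (m∸n≤m j i) j<t
                        , refl , cong c (m+[n∸m]≡n (<⇒≤ i<j)))
    ... | inj₂ eq = inj₂ (j , m ∸ (j ∸ i) , m<n⇒0<n∸m d<m , subst (_≤ h) eq dist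
                        , subst (m ∸ (j ∸ i) <_) (sym t≡m) (∸-monoʳ-< {m} (m<n⇒0<n∸m i<j) (<⇒≤ d<m)) , refl , trans (cong c wrap) (per i))
      where
      open ≡-Reasoning
      d<m : j ∸ i < m
      d<m = ≤-<-trans (m∸n≤m j i) (subst (j <_) t≡m j<t)
      wrap : j + (m ∸ (j ∸ i)) ≡ i + t
      wrap = begin
        j + (m ∸ (j ∸ i))                   ≡⟨ cong (_+ (m ∸ (j ∸ i))) (m+[n∸m]≡n (<⇒≤ i<j)) ⟨
        i + (j ∸ i) + (m ∸ (j ∸ i))         ≡⟨ +-assoc i _ _ ⟩
        i + ((j ∸ i) + (m ∸ (j ∸ i)))       ≡⟨ cong (i +_) (m+[n∸m]≡n (<⇒≤ d<m)) ⟩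
        i + m                               ≡⟨ cong (i +_) t≡m ⟨
        i + t                               ∎

    near : ∀ {a b} → PowEdge H h a b → Near t c a b
    near (i , j , refl , refl , a≢b , dist) with <-cmp (toℕ i) (toℕ j)
    ... | tri≈ _ i≡j _ = ⊥-elim (a≢b (cong c i≡j))
    -- Of the two truncated differences in `cycDist` one is 0, so their maximum is the true
    -- difference.
    ... | tri< i<j _ _ = ordered i<j (toℕ<t j) (subst (λ d → d ⊓ (m ∸ d) ≤ h) (m≤n⇒m⊔n≡n (≤-trans (≤-reflexive (m≤n⇒m∸n≡0 (<⇒≤ i<j))) z≤n)) dist)
    ... | tri> _ _ j<i = swap (ordered j<i (toℕ<t i) (subst (λ d → d ⊓ (m ∸ d) ≤ h) (m≥n⇒m⊔n≡m (≤-trans (≤-reflexive (m≤n⇒m∸n≡0 (<⇒≤ j<i))) z≤n)) dist))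

    distinct : ∀ {a b} → PowEdge H h a b → a ≢ b
    distinct (_ , _ , _ , _ , a≢b , _) = a≢b

  hamiltonian : Fin m → 1 ≤ h → threshold ≤ m →
    Σ (HamCycle m) λ H → (∀ {x y} → PowEdge H h x y → rd x y ≡ 0) ×
      (∀ {x x′ y y′} → PowEdge H h x x′ → PowEdge H h y y′ → x ≢ y′ → x′ ≢ y → 1 ≤ e₂ x y → 1 ≤ e₃ x′ y′ → ⊥)
  hamiltonian v h≥1 large =
    H , (λ e → pair (near e) (distinct e)) , (λ e e′ → quad (near e) (near e′) (distinct e) (distinct e′))
    where
    3≤m : 3 ≤ m
    -- The summand 4h + 2 of the threshold suffices, as h ≥ 1.
    3≤m = ≤-trans (+-monoˡ-≤ 2 (*-mono-≤ {1} {4} (s≤s z≤n) h≥1)) (≤-trans (m≤m+n _ _) (≤-trans (m≤m+n _ _) large))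
    full : Complete.Result h≥1 large m
    full = Complete.conflictFreeArrangement h≥1 large v
    open Cycle (proj₁ full) (proj₂ (proj₂ full)) 3≤m
    open ConflictFree (proj₁ (proj₂ full))

-- Degrees and the numerical hypotheses

edge nonEdge : ∀ {m} → Graph m → Fin m → Fin m → ℕ
edge G a b    = if adj G a b then 1 else 0
nonEdge G a b = if adj G a b then 0 else 1

degree≡∑edge : ∀ {m} (G : Graph m) v → ∑ (allFin m) (edge G v) ≡ degree G v
degree≡∑edge {m} G v = ∑≡sum (allFin m) (edge G v)

nonEdge+edge : ∀ {m} (G : Graph m) v → ∑ (allFin m) (nonEdge G v) + degree G v ≡ m
nonEdge+edge {m} G v = begin
  ∑ (allFin m) (nonEdge G v) + degree G v                   ≡⟨ cong (∑ (allFin m) (nonEdge G v) +_) (degree≡∑edge G v) ⟨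
  ∑ (allFin m) (nonEdge G v) + ∑ (allFin m) (edge G v)      ≡⟨ ∑-+ (allFin m) _ _ ⟨
  ∑ (allFin m) (λ w → nonEdge G v w + edge G v w)           ≡⟨ ∑-cong (allFin m) one ⟩
  ∑ (allFin m) (λ _ → 1)                                    ≡⟨ ∑-const (allFin m) 1 ⟩
  length (allFin m) * 1                                     ≡⟨ trans (*-identityʳ _) (length-allFin m) ⟩
  m                                                         ∎
  where
  open ≡-Reasoning
  one : ∀ w → nonEdge G v w + edge G v w ≡ 1
  one w with adj G v w
  ... | true  = refl
  ... | false = refl

≤-maxList : ∀ {n} {ns : List ℕ} → n ∈ ns → n ≤ foldr _⊔_ 0 ns
≤-maxList (here refl)            = m≤m⊔n _ _
≤-maxList {ns = k ∷ _} (there n∈) = ≤-trans (≤-maxList n∈) (m≤n⊔m k _)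

minList-≤ : ∀ {n} {ns : List ℕ} → n ∈ ns → minList ns ≤ n
minList-≤ {ns = _ ∷ []}    (here refl) = ≤-refl
minList-≤ {ns = _ ∷ _ ∷ _} (here refl) = m⊓n≤m _ _
minList-≤ {ns = k ∷ _ ∷ _} (there n∈)  = ≤-trans (m⊓n≤n k _) (minList-≤ n∈)

degree≤maxDegree : ∀ {m} (G : Graph m) v → degree G v ≤ maxDegree G
degree≤maxDegree G v = ≤-maxList (∈-map⁺ (degree G) (∈-allFin v))

minDegree≤degree : ∀ {m} (G : Graph m) v → minDegree G ≤ degree G v
minDegree≤degree G v = minList-≤ (∈-map⁺ (degree G) (∈-allFin v))

minDegree≤order : ∀ {m} (G : Graph m) → minDegree G ≤ m
minDegree≤order {zero}  G = z≤n
minDegree≤order {suc m} G = ≤-trans (minDegree≤degree G zero)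
  (≤-trans (m≤n+m (degree G zero) (∑ (allFin (suc m)) (nonEdge G zero))) (≤-reflexive (nonEdge+edge G zero)))

-- Put n = 2ℓ - 1 = 2h + 1. Adding n²(m - δ₁) to both sides of the first hypothesis turns its
-- right-hand side into n²m = m + m(n² - 1), and m(n² - 1) cancels. The second hypothesis replaces q
-- by its lower bound.
minDegree-large : ∀ {m} (G : Graph m) {h q D} → 1 ≤ q →
  m * ((2 * suc h ∸ 1) * (2 * suc h ∸ 1) ∸ 1) + (4 * suc h ∸ 3 + q) ≤ (2 * suc h ∸ 1) * (2 * suc h ∸ 1) * minDegree G →
  5 * suc h * (2 * suc h ∸ 1) * D ≤ q ∸ 1 →
  4 * h + 2 + 5 * (h + 1) * (2 * h + 1) * D + (2 * h + 1) * (2 * h + 1) * (m ∸ minDegree G) ≤ m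
minDegree-large {m} G {h} {suc q} {D} _ hyp₁ hyp₂ = +-cancelʳ-≤ (m * N) _ _ (begin
  4 * h + 2 + 5 * (h + 1) * (2 * h + 1) * D + (2 * h + 1) * (2 * h + 1) * (m ∸ δ₁) + m * N
    ≡⟨ s₁ h D (m ∸ δ₁) (m * N) ⟩
  m * N + (4 * h + 1 + suc (5 * suc h * (2 * h + 1) * D)) + (2 * h + 1) * (2 * h + 1) * (m ∸ δ₁)
    ≤⟨ +-monoˡ-≤ ((2 * h + 1) * (2 * h + 1) * (m ∸ δ₁)) (+-monoʳ-≤ (m * N) (+-monoʳ-≤ (4 * h + 1) (s≤s hyp₂′))) ⟩
  m * N + (4 * h + 1 + suc q) + (2 * h + 1) * (2 * h + 1) * (m ∸ δ₁)
    ≤⟨ +-monoˡ-≤ ((2 * h + 1) * (2 * h + 1) * (m ∸ δ₁)) hyp₁′ ⟩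
  (2 * h + 1) * (2 * h + 1) * δ₁ + (2 * h + 1) * (2 * h + 1) * (m ∸ δ₁)
    ≡⟨ *-distribˡ-+ ((2 * h + 1) * (2 * h + 1)) δ₁ (m ∸ δ₁) ⟨
  (2 * h + 1) * (2 * h + 1) * (δ₁ + (m ∸ δ₁))
    ≡⟨ cong ((2 * h + 1) * (2 * h + 1) *_) (m+[n∸m]≡n (minDegree≤order G)) ⟩
  (2 * h + 1) * (2 * h + 1) * m
    ≡⟨ s₂ h m ⟩
  m + m * N ∎)
  where
  open ≤-Reasoning
  δ₁ N : ℕ
  δ₁ = minDegree G
  N  = 4 * h * h + 4 * h
  n≡ : 2 * suc h ∸ 1 ≡ 2 * h + 1
  n≡ = trans (cong (_∸ 1) (lem h)) (m+n∸n≡m (2 * h + 1) 1)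
    where
    lem : ∀ h → 2 * suc h ≡ 2 * h + 1 + 1
    lem = solve-∀
  n²∸1≡ : (2 * h + 1) * (2 * h + 1) ∸ 1 ≡ N
  n²∸1≡ = trans (cong (_∸ 1) (lem h)) (m+n∸n≡m N 1)
    where
    lem : ∀ h → (2 * h + 1) * (2 * h + 1) ≡ 4 * h * h + 4 * h + 1
    lem = solve-∀
  4ℓ∸3≡ : 4 * suc h ∸ 3 ≡ 4 * h + 1
  4ℓ∸3≡ = trans (cong (_∸ 3) (lem h)) (m+n∸n≡m (4 * h + 1) 3)
    where
    lem : ∀ h → 4 * suc h ≡ 4 * h + 1 + 3
    lem = solve-∀
  hyp₁′ : m * N + (4 * h + 1 + suc q) ≤ (2 * h + 1) * (2 * h + 1) * δ₁
  hyp₁′ = subst₂ (λ a b → m * a + (b + suc q) ≤ (2 * h + 1) * (2 * h + 1) * δ₁) n²∸1≡ 4ℓ∸3≡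
    (subst (λ n → m * (n * n ∸ 1) + (4 * suc h ∸ 3 + suc q) ≤ n * n * δ₁) n≡ hyp₁)
  hyp₂′ : 5 * suc h * (2 * h + 1) * D ≤ q
  hyp₂′ = subst (λ n → 5 * suc h * n * D ≤ q) n≡ hyp₂
  s₁ : ∀ h D r s → 4 * h + 2 + 5 * (h + 1) * (2 * h + 1) * D + (2 * h + 1) * (2 * h + 1) * r + s ≡
       s + (4 * h + 1 + suc (5 * suc h * (2 * h + 1) * D)) + (2 * h + 1) * (2 * h + 1) * r
  s₁ = solve-∀
  s₂ : ∀ h m → (2 * h + 1) * (2 * h + 1) * m ≡ m + m * (4 * h * h + 4 * h)
  s₂ = solve-∀

theorem4 : (m : ℕ) (G1 G2 G3 : Graph m) (ℓ q : ℕ) →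
    2 ≤ ℓ → 1 ≤ q →
    m * ((2 * ℓ ∸ 1) * (2 * ℓ ∸ 1) ∸ 1) + (4 * ℓ ∸ 3 + q)
    ≤ (2 * ℓ ∸ 1) * (2 * ℓ ∸ 1) * minDegree G1 →
    5 * ℓ * (2 * ℓ ∸ 1) * (maxDegree G2 * maxDegree G3) ≤ q ∸ 1 →
    Σ (HamCycle m) λ H →
    PowSubgraph H (ℓ ∸ 1) G1 × ¬ AltBag (PowEdge H (ℓ ∸ 1)) ℓ G2 G3
-- Without vertices the right-hand side of `hyp₁` is 0, although q ≥ 1.
theorem4 zero G1 G2 G3 (suc h) q (s≤s _) q≥1 hyp₁ _ =
  ⊥-elim (<⇒≱ q≥1 (≤-trans (m≤n+m q (4 * suc h ∸ 3)) (≤-trans hyp₁ (≤-reflexive (*-zeroʳ ((2 * suc h ∸ 1) * (2 * suc h ∸ 1)))))))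
theorem4 m@(suc _) G1 G2 G3 (suc h) q (s≤s h≥1) q≥1 hyp₁ hyp₂ = H , subgraph , noBag
  where
  large : 4 * h + 2 + 5 * (h + 1) * (2 * h + 1) * (maxDegree G2 * maxDegree G3) +
          (2 * h + 1) * (2 * h + 1) * (m ∸ minDegree G1) ≤ m
  large = minDegree-large G1 {h} {q} {maxDegree G2 * maxDegree G3} q≥1 hyp₁ hyp₂

  degree-bound : (G : Graph m) → ∀ v → ∑ (allFin m) (edge G v) ≤ maxDegree G
  degree-bound G v = ≤-trans (≤-reflexive (degree≡∑edge G v)) (degree≤maxDegree G v)

  nonDegree-bound : ∀ v → ∑ (allFin m) (nonEdge G1 v) ≤ m ∸ minDegree G1
  nonDegree-bound v = m+n≤o⇒m≤o∸n _ (≤-trans (+-monoʳ-≤ _ (minDegree≤degree G1 v)) (≤-reflexive (nonEdge+edge G1 v)))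

  edge-irrefl : (G : Graph m) → ∀ v → edge G v v ≡ 0
  edge-irrefl G v = cong (λ b → if b then 1 else 0) (irrefl G v)

  edge-sym : (G : Graph m) → ∀ a b → edge G a b ≡ edge G b a
  edge-sym G a b = cong (λ b → if b then 1 else 0) (adj-sym G a b)

  cycle : Σ (HamCycle m) λ H → (∀ {x y} → PowEdge H h x y → nonEdge G1 x y ≡ 0) ×
    (∀ {x x′ y y′} → PowEdge H h x x′ → PowEdge H h y y′ → x ≢ y′ → x′ ≢ y → 1 ≤ edge G2 x y → 1 ≤ edge G3 x′ y′ → ⊥)
  cycle = Weights.hamiltonian h (maxDegree G2) (maxDegree G3) (m ∸ minDegree G1) (edge G2) (edge G3) (nonEdge G1)
    (edge-sym G2) (edge-sym G3) (λ a b → cong (λ b → if b then 0 else 1) (adj-sym G1 a b))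
    (edge-irrefl G2) (edge-irrefl G3) (degree-bound G2) (degree-bound G3) nonDegree-bound zero h≥1 large

  H : HamCycle m
  H = proj₁ cycle

  isEdge : ∀ b → (if b then 0 else 1) ≡ 0 → b ≡ true
  isEdge true  _ = refl
  isEdge false ()

  subgraph : PowSubgraph H h G1
  subgraph a b e = isEdge (adj G1 a b) (proj₁ (proj₂ cycle) e)

  -- The ends of the two edges in A₁ are distinct members of a clique, hence near each other, and so
  -- are those in A₂. As A₁ and A₂ are disjoint, this is a configuration that `cycle` excludes.
  noBag : ¬ AltBag (PowEdge H h) (suc h) G2 G3
  noBag (a₁ , a₂ , (_ , clique₁) , (_ , clique₂) , disjoint , i₂ , j₂ , i₃ , j₃ , e₂ , e₃ , ≢₁ , _ , _ , ≢₂) =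
    proj₂ (proj₂ cycle) (clique₁ i₂ i₃ (≢₁ ∘ cong a₁)) (clique₂ j₂ j₃ (≢₂ ∘ cong a₂)) (disjoint i₂ j₃) (disjoint i₃ j₂)
      (≤-reflexive (sym (cong (λ b → if b then 1 else 0) e₂))) (≤-reflexive (sym (cong (λ b → if b then 1 else 0) e₃)))
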